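{- Let $\mathrm{st}:\mathfrak{S}\to\mathbb{N}$ be a permutation statistic for which there is a function $f:\mathbb{N}^2\to\mathbb{N}$ such that for all integers $0\le k\le n$ and all $\sigma_1\in\mathfrak{S}_k(312)$, $\sigma_2\in\mathfrak{S}_{n-k}(312)$, the permutation $\sigma=213[\sigma_1,1,\sigma_2]$ satisfies $$\mathrm{st}(\sigma)=f(k,n-k)+\mathrm{st}(\sigma_1)+\mathrm{st}(\sigma_2).$$ Let $r\ge 0$ and let $\pi_1,\dots,\pi_r,\pi'_1,\dots,\pi'_r$ be permutations such that, for every $i\in\{1,\dots,r\}$, the sets $\{312,\pi_i\}$ and $\{312,\pi'_i\}$ are $\mathrm{st}$-Wilf equivalent. Set $\pi=\iota_r[\pi_{1*},\dots,\pi_{r*}]$ and $\pi'=\iota_r[\pi'_{1*},\dots,\pi'_{r*}]$. Then $\{312,\pi\}$ and $\{312,\pi'\}$ are also $\mathrm{st}$-Wilf equivalent, i.e. $F^{\mathrm{st}}_n(\{312,\pi\};q)=F^{\mathrm{st}}_n(\{312,\pi'\};q)$ for all $n\ge 0$.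
   Context: $\mathbb{N}$ is the set of nonnegative integers. $\mathfrak{S}_n$ is the set of permutations of $\{1,\dots,n\}$ in one-line notation, $\mathfrak{S}=\bigcup_{n\ge 0}\mathfrak{S}_n$, and $\mathfrak{S}_0=\{\epsilon\}$ with $\epsilon$ the empty permutation. A permutation $\sigma$ contains $\pi$ if some subsequence of $\sigma$ has the same relative order as $\pi$ (so every permutation contains $\epsilon$); otherwise $\sigma$ avoids $\pi$. For $\Pi\subseteq\mathfrak{S}$, $\mathfrak{S}_n(\Pi)$ is the set of $\sigma\in\mathfrak{S}_n$ avoiding every pattern in $\Pi$; $\mathfrak{S}_n(312)=\mathfrak{S}_n(\{312\})$. For a statistic $\mathrm{st}:\mathfrak{S}\to\mathbb{N}$, $F^{\mathrm{st}}_n(\Pi;q)=\sum_{\sigma\in\mathfrak{S}_n(\Pi)}q^{\mathrm{st}(\sigma)}$, and $\Pi,\Pi'$ are $\mathrm{st}$-Wilf equivalent if $F^{\mathrm{st}}_n(\Pi;q)=F^{\mathrm{st}}_n(\Pi';q)$ for all $n\ge 0$. For $\tau\in\mathfrak{S}_k$ and $\sigma_1,\dots,\sigma_k\in\mathfrak{S}$, the inflation $\tau[\sigma_1,\dots,\sigma_k]$ is the permutation that is a concatenation of $k$ consecutive blocks of positions, the $i$-th block (of length $|\sigma_i|$) having the relative order of $\sigma_i$ and occupying an interval of values, with the blocks' value intervals arranged relative to one another in the order of $\tau$; e.g. $213[123,1,21]=234165$. $\iota_r=12\cdots r$ is the identity of $\mathfrak{S}_r$ (and $\iota_0[\,]=\epsilon$).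 For $\pi\in\mathfrak{S}_m$, $\pi_*:=21[\pi,1]$, i.e. $\pi_*=(\pi(1)+1)\cdots(\pi(m)+1)\,1$; and $\pi_{i*}=(\pi_i)_*$. -}

module Defs where

open import Data.Bool using (if_then_else_)
open import Data.List using
  (List; []; _∷_; [_]; length; map; concatMap; filter; foldr; mapMaybe;
   applyUpTo; zip; cartesianProductWith)
open import Data.List.Membership.Propositional using (_∈_)
open import Data.List.Membership.Propositional.Properties using (∈-map⁻)
open import Data.List.Properties using (length-++; length-map; length-applyUpTo)
open import Data.List.Relation.Binary.Sublist.Propositional using (_⊆_; []; _∷_; _∷ʳ_)
open import Data.List.Relation.Unary.All as All using (All; []; _∷_)
import Data.List.Relation.Unary.All.Properties as All
open import Data.List.Relation.Unary.AllPairs as AllPairs using (AllPairs; []; _∷_; allPairs?)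
import Data.List.Relation.Unary.AllPairs.Properties as AllPairs
open import Data.List.Relation.Unary.Any using (here; there)
open import Data.List.Relation.Unary.Unique.Propositional using (Unique)
import Data.List.Relation.Unary.Unique.Propositional.Properties as Unique
open import Data.Maybe using (Maybe)
import Data.Maybe as Maybe
open import Data.Nat using
  (ℕ; zero; suc; _+_; _≤_; _<_; _≤?_; _<?_; _≟_; _≡ᵇ_; z≤n; s≤s)
open import Data.Nat.ListAction using (sum)
open import Data.Nat.Properties
open import Data.List.Relation.Unary.Unique.DecPropositional _≟_ using (unique?)
open import Data.Product using (∃; _×_; _,_; proj₁; proj₂)
open import Data.Vec using (Vec; []; _∷_; toList; cast)
import Data.Vec as Vec
open import Function using (_∘_; _⇔_; mk⇔; Equivalence)
open import Level using (Level)
open import Relation.Binary using (tri<; tri≈; tri>)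
open import Relation.Binary.PropositionalEquality
  using (_≡_; _≢_; refl; sym; trans; cong; cong₂; subst; _≗_)
open import Relation.Nullary
  using (Dec; yes; no; ¬_; ¬?; True; toWitness; map′; _×-dec_; _→-dec_; recompute;
         contradiction; dec⇒maybe)
open import Relation.Unary using (Pred; Decidable)

private variable
  a p ℓ : Level
  A : Set a
  r : ℕ

-- A word of length n with distinct entries in {1,…,n}.
IsPermutation : List ℕ → Set
IsPermutation w = All (λ x → 1 ≤ x × x ≤ length w) w × Unique w

isPermutation? : Decidable IsPermutation
isPermutation? w = All.all? (λ x → (1 ≤? x) ×-dec (x ≤? length w)) w ×-dec unique? w

-- The proof field is irrelevant, so permutations with equal words are
-- equal and a statistic 𝔖 → ℕ depends on the word only.
record 𝔖 : Set where
  constructor mk𝔖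
  field
    word           : List ℕ
    .isPermutation : IsPermutation word

open 𝔖 public using (word)

size : 𝔖 → ℕ
size σ = length (word σ)

perm : (w : List ℕ) {_ : True (isPermutation? w)} → 𝔖
perm w {t} = mk𝔖 w (toWitness t)

word-isPermutation : ∀ σ → IsPermutation (word σ)
word-isPermutation (mk𝔖 w w-perm) = recompute (isPermutation? w) w-perm

-- AllPairs ranges over the pairs of positions i < j; comparing only
-- with _<_ suffices because the words concerned have distinct entries.
SameRelativeOrder : List ℕ → List ℕ → Set
SameRelativeOrder u v =
  length u ≡ length v ×
  AllPairs (λ (uᵢ , vᵢ) (uⱼ , vⱼ) → (uᵢ < uⱼ) ⇔ (vᵢ < vⱼ)) (zip u v)

_Contains_ : 𝔖 → 𝔖 → Set
σ Contains π = ∃ λ u → u ⊆ word σ × SameRelativeOrder u (word π)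

-- Pattern sets are finite and given by a list of their elements.
_Avoids_ : 𝔖 → List 𝔖 → Set
σ Avoids Π = All (λ π → ¬ (σ Contains π)) Π

sameRelativeOrder? : ∀ u v → Dec (SameRelativeOrder u v)
sameRelativeOrder? u v =
  (length u ≟ length v) ×-dec
  allPairs? (λ (uᵢ , vᵢ) (uⱼ , vⱼ) → (uᵢ <? uⱼ) ⇔? (vᵢ <? vⱼ)) (zip u v)
  where
  _⇔?_ : {P Q : Set} → Dec P → Dec Q → Dec (P ⇔ Q)
  P? ⇔? Q? = map′ (λ (f , g) → mk⇔ f g)
                  (λ e → Equivalence.to e , Equivalence.from e)
                  ((P? →-dec Q?) ×-dec (Q? →-dec P?))

anySublist? : {P : Pred (List A) p} → Decidable P → ∀ xs → Dec (∃ λ ys → ys ⊆ xs × P ys)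
anySublist? P? [] = map′ (λ q → [] , [] , q) (λ { ([] , [] , q) → q }) (P? [])
anySublist? P? (x ∷ xs) with anySublist? P? xs | anySublist? (P? ∘ (x ∷_)) xs
... | yes (ys , s , q) | _                = yes (ys , x ∷ʳ s , q)
... | no _             | yes (ys , s , q) = yes (x ∷ ys , refl ∷ s , q)
... | no ¬skip         | no ¬keep         = no λ
  { (ys       , _ ∷ʳ s   , q) → ¬skip (ys , s , q)
  ; (_ ∷ ys   , refl ∷ s , q) → ¬keep (ys , s , q) }

_contains?_ : ∀ σ π → Dec (σ Contains π)
σ contains? π = anySublist? (λ u → sameRelativeOrder? u (word π)) (word σ)

_avoids?_ : ∀ σ Π → Dec (σ Avoids Π)
σ avoids? Π = All.all? (λ π → ¬? (σ contains? π)) Π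

wordsOver : List ℕ → ℕ → List (List ℕ)
wordsOver alphabet zero    = [ [] ]
wordsOver alphabet (suc l) = cartesianProductWith _∷_ alphabet (wordsOver alphabet l)

toPermutation : List ℕ → Maybe 𝔖
toPermutation w = Maybe.map (λ w-perm → mk𝔖 w w-perm) (dec⇒maybe (isPermutation? w))

-- Each permutation of {1,…,n} occurs exactly once in this list.
permutations : ℕ → List 𝔖
permutations n = mapMaybe toPermutation (wordsOver (applyUpTo suc n) n)

𝔖[_,_] : ℕ → List 𝔖 → List 𝔖
𝔖[ n , Π ] = filter (_avoids? Π) (permutations n)

-- Polynomials in q with coefficients in ℕ, as coefficient sequences;
-- equality of polynomials is _≗_.
ℕ[q] : Set
ℕ[q] = ℕ → ℕ

q^_ : ℕ → ℕ[q]
(q^ m) j = if m ≡ᵇ j then 1 else 0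

0ₚ : ℕ[q]
0ₚ _ = 0

_+ₚ_ : ℕ[q] → ℕ[q] → ℕ[q]
(f +ₚ g) j = f j + g j

F : (𝔖 → ℕ) → ℕ → List 𝔖 → ℕ[q]
F st n Π = foldr _+ₚ_ 0ₚ (map (λ σ → q^ (st σ)) 𝔖[ n , Π ])

WilfEquivalent : (𝔖 → ℕ) → List 𝔖 → List 𝔖 → Set
WilfEquivalent st Π Π′ = ∀ n → F st n Π ≗ F st n Π′

-- The blocks of τ[σ₁,…,σₖ] are given as the pairs (τ(i) , σᵢ), in order
-- of position.  The values of the i-th block start right above those of
-- all blocks j with τ(j) < τ(i).
totalSize : List (ℕ × 𝔖) → ℕ
totalSize = sum ∘ map (size ∘ proj₂)

offset : List (ℕ × 𝔖) → ℕ → ℕ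
offset bs t = totalSize (filter (λ b → proj₁ b <? t) bs)

block : List (ℕ × 𝔖) → ℕ × 𝔖 → List ℕ
block bs (t , σ) = map (offset bs t +_) (word σ)

inflateWord : List (ℕ × 𝔖) → List ℕ
inflateWord bs = concatMap (block bs) bs

private
  length-blocks : ∀ bs cs → length (concatMap (block bs) cs) ≡ totalSize cs
  length-blocks bs []             = refl
  length-blocks bs (c@(_ , σ) ∷ cs) = trans (length-++ (block bs c))
    (cong₂ _+_ (length-map _ (word σ)) (length-blocks bs cs))

  filter-≤ : {P Q : Pred (ℕ × 𝔖) ℓ} (P? : Decidable P) (Q? : Decidable Q) →
             (∀ {b} → P b → Q b) → ∀ bs →
             totalSize (filter P? bs) ≤ totalSize (filter Q? bs)
  filter-≤ P? Q? P⇒Q [] = z≤n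
  filter-≤ P? Q? P⇒Q (b ∷ bs) with P? b | Q? b
  ... | yes _  | yes _ = +-monoʳ-≤ (size (proj₂ b)) (filter-≤ P? Q? P⇒Q bs)
  ... | yes Pb | no ¬Q = contradiction (P⇒Q Pb) ¬Q
  ... | no _   | yes _ = ≤-trans (filter-≤ P? Q? P⇒Q bs) (m≤n+m _ (size (proj₂ b)))
  ... | no _   | no _  = filter-≤ P? Q? P⇒Q bs

  filter-< : {P Q : Pred (ℕ × 𝔖) ℓ} (P? : Decidable P) (Q? : Decidable Q) →
             (∀ {b} → P b → Q b) → ∀ {b} bs → b ∈ bs → ¬ P b → Q b →
             size (proj₂ b) + totalSize (filter P? bs) ≤ totalSize (filter Q? bs)
  filter-< P? Q? P⇒Q {b} (_ ∷ bs) (here refl) ¬Pb Qb with P? b | Q? b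
  ... | yes Pb | _     = contradiction Pb ¬Pb
  ... | no _   | no ¬Q = contradiction Qb ¬Q
  ... | no _   | yes _ = +-monoʳ-≤ (size (proj₂ b)) (filter-≤ P? Q? P⇒Q bs)
  filter-< P? Q? P⇒Q {b} (c ∷ bs) (there b∈) ¬Pb Qb with P? c | Q? c
  ... | yes Pc | no ¬Q = contradiction (P⇒Q Pc) ¬Q
  ... | no _   | yes _ = ≤-trans (filter-< P? Q? P⇒Q bs b∈ ¬Pb Qb) (m≤n+m _ (size (proj₂ c)))
  ... | no _   | no _  = filter-< P? Q? P⇒Q bs b∈ ¬Pb Qb
  ... | yes _  | yes _ = begin
    sb + (sc + P) ≡⟨ sym (+-assoc sb sc P) ⟩
    (sb + sc) + P ≡⟨ cong (_+ P) (+-comm sb sc) ⟩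
    (sc + sb) + P ≡⟨ +-assoc sc sb P ⟩
    sc + (sb + P) ≤⟨ +-monoʳ-≤ sc (filter-< P? Q? P⇒Q bs b∈ ¬Pb Qb) ⟩
    sc + totalSize (filter Q? bs) ∎
    where
    open ≤-Reasoning
    sb = size (proj₂ b)
    sc = size (proj₂ c)
    P = totalSize (filter P? bs)

  filter-total : {P : Pred (ℕ × 𝔖) ℓ} (P? : Decidable P) →
                 ∀ bs → totalSize (filter P? bs) ≤ totalSize bs
  filter-total P? [] = z≤n
  filter-total P? (b ∷ bs) with P? b
  ... | yes _ = +-monoʳ-≤ (size (proj₂ b)) (filter-total P? bs)
  ... | no _  = ≤-trans (filter-total P? bs) (m≤n+m _ (size (proj₂ b)))

  offset-step : ∀ bs {t u σ} → (t , σ) ∈ bs → t < u → offset bs t + size σ ≤ offset bs u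
  offset-step bs {t} {u} {σ} b∈ t<u = subst (_≤ offset bs u) (+-comm (size σ) _)
    (filter-< (λ b → proj₁ b <? t) (λ b → proj₁ b <? u) (λ v<t → <-trans v<t t<u)
       bs b∈ (<-irrefl refl) t<u)

  offset-bound : ∀ bs {t σ} → (t , σ) ∈ bs → offset bs t + size σ ≤ totalSize bs
  offset-bound bs {t} b∈ = ≤-trans (offset-step bs b∈ (n<1+n t)) (filter-total _ bs)

  disjoint : ∀ bs {t u σ ρ x} → (t , σ) ∈ bs → t < u →
             x ∈ block bs (t , σ) → ¬ (x ∈ block bs (u , ρ))
  disjoint bs {t} {u} {σ} {ρ} {x} b∈ t<u x∈σ x∈ρ
    with y , y∈ , refl ← ∈-map⁻ (offset bs t +_) x∈σ
       | z , z∈ , eq ← ∈-map⁻ (offset bs u +_) x∈ρ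
    = <-irrefl eq (begin-strict
        offset bs t + y ≤⟨ +-monoʳ-≤ _ (proj₂ (All.lookup (proj₁ (word-isPermutation σ)) y∈)) ⟩
        offset bs t + size σ ≤⟨ offset-step bs b∈ t<u ⟩
        offset bs u <⟨ m<m+n _ (proj₁ (All.lookup (proj₁ (word-isPermutation ρ)) z∈)) ⟩
        offset bs u + z ∎)
    where open ≤-Reasoning

  allPairs-∈ : {R S : ℕ × 𝔖 → ℕ × 𝔖 → Set} → ∀ {bs} →
               (∀ {b c} → b ∈ bs → c ∈ bs → R b c → S b c) →
               AllPairs R bs → AllPairs S bs
  allPairs-∈ f []         = []
  allPairs-∈ f (Rb ∷ Rbs) =
    All.tabulate (λ c∈ → f (here refl) (there c∈) (All.lookup Rb c∈))
    ∷ allPairs-∈ (λ b∈ c∈ → f (there b∈) (there c∈)) Rbs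

  inflateWord-isPermutation :
    ∀ bs → AllPairs (λ b c → proj₁ b ≢ proj₁ c) bs → IsPermutation (inflateWord bs)
  inflateWord-isPermutation bs distinct =
    All.concat⁺ (All.map⁺ (All.tabulate inRange)) ,
    Unique.concat⁺
      (All.map⁺ (All.tabulate λ {(t , σ)} _ →
        Unique.map⁺ (+-cancelˡ-≡ (offset bs t) _ _) (proj₂ (word-isPermutation σ))))
      (AllPairs.map⁺ (allPairs-∈ blocksDisjoint distinct))
    where
    inRange : ∀ {b} → b ∈ bs →
              All (λ x → 1 ≤ x × x ≤ length (inflateWord bs)) (block bs b)
    inRange {t , σ} b∈ = All.map⁺ (All.map
      (λ (1≤x , x≤σ) → ≤-trans 1≤x (m≤n+m _ (offset bs t)) ,
        ≤-trans (+-monoʳ-≤ _ x≤σ)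
          (≤-trans (offset-bound bs b∈) (≤-reflexive (sym (length-blocks bs bs)))))
      (proj₁ (word-isPermutation σ)))

    blocksDisjoint : ∀ {b c} → b ∈ bs → c ∈ bs → proj₁ b ≢ proj₁ c →
                     ∀ {x} → ¬ (x ∈ block bs b × x ∈ block bs c)
    blocksDisjoint {t , σ} {u , ρ} b∈ c∈ t≢u (x∈b , x∈c) with <-cmp t u
    ... | tri< t<u _ _ = disjoint bs {ρ = ρ} b∈ t<u x∈b x∈c
    ... | tri≈ _ t≡u _ = t≢u t≡u
    ... | tri> _ _ u<t = disjoint bs {ρ = σ} c∈ u<t x∈c x∈b

  zip-distinct : {w : List ℕ} → Unique w → (σs : List 𝔖) →
                 AllPairs (λ b c → proj₁ b ≢ proj₁ c) (zip w σs)
  zip-distinct []       σs       = []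
  zip-distinct (_ ∷ _)  []       = []
  zip-distinct {t ∷ w} (t∉ ∷ u) (σ ∷ σs) = zip-All t∉ σs ∷ zip-distinct u σs
    where
    zip-All : {w : List ℕ} → All (t ≢_) w → (σs : List 𝔖) → All (λ c → t ≢ proj₁ c) (zip w σs)
    zip-All []       σs       = []
    zip-All (_ ∷ _)  []       = []
    zip-All (q ∷ qs) (_ ∷ σs) = q ∷ zip-All qs σs

inflate : (τ : 𝔖) → Vec 𝔖 (size τ) → 𝔖
inflate τ σs = mk𝔖 (inflateWord bs)
  (inflateWord-isPermutation bs
    (zip-distinct (proj₂ (word-isPermutation τ)) (toList σs)))
  where bs = zip (word τ) (toList σs)

ι : ℕ → 𝔖
ι r = mk𝔖 (applyUpTo suc r)
  ( All.applyUpTo⁺₁ suc r (λ i<r → s≤s z≤n , ≤-trans i<r (≤-reflexive (sym (length-applyUpTo suc r))))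
  , Unique.applyUpTo⁺₁ suc r (λ i<j _ → <⇒≢ i<j ∘ suc-injective))

ι[_] : Vec 𝔖 r → 𝔖
ι[_] {r} σs = inflate (ι r) (cast (sym (length-applyUpTo suc r)) σs)

p1 p21 p213 p312 : 𝔖
p1   = perm (1 ∷ [])
p21  = perm (2 ∷ 1 ∷ [])
p213 = perm (2 ∷ 1 ∷ 3 ∷ [])
p312 = perm (3 ∷ 1 ∷ 2 ∷ [])

_* : 𝔖 → 𝔖
π * = inflate p21 (π ∷ p1 ∷ [])

{-# OPTIONS --safe #-}

-- A nonempty 312-avoiding permutation is uniquely 213[σ₁,1,σ₂] = σ₁* ⊕ σ₂ with σ₁, σ₂ avoiding 312.
-- Every summand πᵢ* ends with its least letter, so an occurrence of π₁* ⊕ ⋯ ⊕ πᵣ* in σ₁* ⊕ σ₂ puts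
-- the first j summands into σ₁* and the others into σ₂, for some j; and σ₁* contains
-- π₁* ⊕ ⋯ ⊕ πⱼ* iff σ₁ does when j ≥ 2, and iff σ₁ contains π₁ when j = 1.  Containment of the
-- first j summands decreases with j and containment of the others increases, so the indicator of
-- the union over j telescopes into a combination of products of an indicator in σ₁ and one in σ₂.
-- By strong induction on n, for all sequences of patterns at once, the distribution of st over the
-- permutations of size n containing the sum depends only on the distributions for the single πᵢ.
module Submission where

open import Defs
open import Data.Bool using (if_then_else_)
open import Data.Empty using (⊥-elim)
open import Data.Fin using (Fin; zero; suc)
open import Data.List as List
  using (List; []; _∷_; [_]; _++_; length; take; drop; zip; applyUpTo; upTo; concatMap; filter;
         foldr; mapMaybe; cartesianProductWith)
open import Data.List.Membership.Propositional using (_∈_; _∉_; find; lose)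
open import Data.List.Membership.Propositional.Properties
open import Data.List.Membership.Propositional.Properties.WithK using (unique∧set⇒bag)
open import Data.List.Properties
  using (++-assoc; ++-conicalʳ; ++-identityʳ; ∷-injective; ∷ʳ-injective; filter-++; filter-accept;
         filter-all; filter-none; filter-reject; length-++; length-applyUpTo; length-map; map-++;
         map-∘; map-cong; map-id; map-injective; map-upTo; take++drop≡id; upTo-∷ʳ)
open import Data.List.Relation.Binary.BagAndSetEquality using (∼bag⇒↭)
open import Data.List.Relation.Binary.Disjoint.Propositional using (Disjoint)
open import Data.List.Relation.Binary.Permutation.Propositional using (_↭_)
open import Data.List.Relation.Binary.Permutation.Propositional.Properties
  using () renaming (map⁺ to ↭-map⁺)
open import Data.List.Relation.Binary.Pointwise as Pointwise using (Pointwise; []; _∷_)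
open import Data.List.Relation.Binary.Sublist.Propositional
  using (_⊆_; []; _∷_; _∷ʳ_; ⊆-refl; ⊆-trans; from∈)
open import Data.List.Relation.Binary.Sublist.Propositional.Properties
  using (All-resp-⊆; ++⁺ˡ; ++⁺ʳ; length-mono-≤) renaming (++⁺ to ⊆-++⁺; map⁺ to ⊆-map⁺)
open import Data.List.Relation.Unary.All as All using (All; []; _∷_)
import Data.List.Relation.Unary.All.Properties as All
open import Data.List.Relation.Unary.AllPairs as AllPairs using (AllPairs; []; _∷_)
import Data.List.Relation.Unary.AllPairs.Properties as AllPairs
open import Data.List.Relation.Unary.Any using (here; there)
open import Data.List.Relation.Unary.Unique.Propositional using (Unique)
import Data.List.Relation.Unary.Unique.Propositional.Properties as Unique
open import Data.Nat
  using (ℕ; zero; suc; _+_; _*_; _∸_; _≤_; _<_; z≤n; s≤s; z<s; _<?_; _≟_)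
open import Data.List.Membership.DecPropositional _≟_ using (_∈?_)
open import Data.Nat.Induction using (<-rec)
open import Data.Nat.ListAction using (sum)
open import Data.Nat.ListAction.Properties using (sum-++; sum-↭)
open import Data.Nat.Properties
open import Algebra.Properties.CommutativeSemigroup +-commutativeSemigroup using (interchange)
open import Algebra.Properties.CommutativeSemigroup *-commutativeSemigroup using (x∙yz≈y∙xz)
open import Data.Product using (∃; ∃₂; _×_; _,_; proj₁; proj₂)
open import Data.Sum using (_⊎_; inj₁; inj₂)
open import Data.Vec using (Vec; []; _∷_; lookup; map; toList)
open import Data.Vec.Properties using (toList-map; toList-cast; length-toList)
open import Function using (_∘_; _⇔_; mk⇔; Equivalence; case_of_)
open import Relation.Binary.PropositionalEquality hiding ([_])
open import Relation.Nullary using (¬_; Dec; yes; no; does; contradiction; _×-dec_)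
open import Relation.Unary using (Decidable)

-- The hypotheses control one containment event at a time, never two of them jointly, whereas
-- expanding a union over cuts would in general bring in joint events. The chains prevent this:
-- inside one factor, the intersection of two consecutive events is again one of the two, so every
-- surviving term carries a single event on each side. Containment is tracked instead of avoidance
-- because an occurrence in a direct sum is an existential over cuts; the complement inside the
-- 312-avoiders is taken only when entering and leaving the argument. The exponent of `213[σ₁,1,σ₂]`
-- mixes both factors and the function `f`. Equidistribution is therefore tested against arbitrary
-- functions of the statistic rather than coefficient by coefficient, so that one factor can be
-- exchanged while the value of the other is frozen inside the test function.

private variable
  A B C : Set
  x y : ℕ
  u u₁ u₂ v v₁ v₂ w p p₁ p₂ : List ℕ
  σ π ρ τ : 𝔖

-- Pointwise relations, concatenation and sublists

module _ {P : A → Set} {Q : B → Set} {R : A → B → Set} where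

  Pointwise-All : (∀ {a b} → R a b → P a → Q b) →
                  ∀ {xs ys} → Pointwise R xs ys → All P xs → All Q ys
  Pointwise-All f []       []       = []
  Pointwise-All f (r ∷ rs) (p ∷ ps) = f r p ∷ Pointwise-All f rs ps

  All-Pointwise : (∀ {a b} → P a → Q b → R a b) →
                  ∀ {xs ys} → length xs ≡ length ys → All P xs → All Q ys → Pointwise R xs ys
  All-Pointwise f eq []       []       = []
  All-Pointwise f eq (p ∷ ps) (q ∷ qs) = f p q ∷ All-Pointwise f (suc-injective eq) ps qs

++-≡-++ : ∀ (xs : List A) {ys} us {vs} → xs ++ ys ≡ us ++ vs →
          (∃ λ ws → us ≡ xs ++ ws × ys ≡ ws ++ vs) ⊎
          (∃₂ λ z zs → xs ≡ us ++ z ∷ zs × vs ≡ z ∷ zs ++ ys)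
++-≡-++ []       us       eq = inj₁ (us , refl , eq)
++-≡-++ (x ∷ xs) []       eq = inj₂ (x , xs , refl , sym eq)
++-≡-++ (x ∷ xs) (_ ∷ us) eq with refl , eq′ ← ∷-injective eq with ++-≡-++ xs us eq′
... | inj₁ (ws , refl , q)    = inj₁ (ws , refl , q)
... | inj₂ (z , zs , refl , q) = inj₂ (z , zs , refl , q)

⊆-++⁻ : ∀ (xs : List A) {ys us} → us ⊆ xs ++ ys →
        ∃₂ λ us₁ us₂ → us ≡ us₁ ++ us₂ × us₁ ⊆ xs × us₂ ⊆ ys
⊆-++⁻ []       s = [] , _ , refl , [] , s
⊆-++⁻ (x ∷ xs) (_ ∷ʳ s) with us₁ , us₂ , refl , s₁ , s₂ ← ⊆-++⁻ xs s =
  us₁ , us₂ , refl , x ∷ʳ s₁ , s₂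
⊆-++⁻ (x ∷ xs) (refl ∷ s) with us₁ , us₂ , refl , s₁ , s₂ ← ⊆-++⁻ xs s =
  x ∷ us₁ , us₂ , refl , refl ∷ s₁ , s₂

⊆-map⁻ : (f : A → B) → ∀ xs {us} → us ⊆ List.map f xs → ∃ λ ws → us ≡ List.map f ws × ws ⊆ xs
⊆-map⁻ f []       [] = [] , refl , []
⊆-map⁻ f (x ∷ xs) (_ ∷ʳ s) with ws , refl , s′ ← ⊆-map⁻ f xs s = ws , refl , x ∷ʳ s′
⊆-map⁻ f (x ∷ xs) (refl ∷ s) with ws , refl , s′ ← ⊆-map⁻ f xs s = x ∷ ws , refl , refl ∷ s′

⊆-[] : {us : List A} → us ⊆ [] → us ≡ []
⊆-[] [] = refl

-- Order isomorphism of words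

OrderAgrees : ℕ → ℕ → List ℕ → List ℕ → Set
OrderAgrees x y = Pointwise (λ a b → (x < a) ⇔ (y < b))

infix 4 _≈_

-- An inductive form of `SameRelativeOrder`: without the `zip` and the separate length equation, a
-- match can be cut and concatenated by recursion.
data _≈_ : List ℕ → List ℕ → Set where
  []  : [] ≈ []
  _∷_ : OrderAgrees x y u v → u ≈ v → (x ∷ u) ≈ (y ∷ v)

sameRelativeOrder⇒≈ : ∀ u v → SameRelativeOrder u v → u ≈ v
sameRelativeOrder⇒≈ []      []      _              = []
sameRelativeOrder⇒≈ (x ∷ u) (y ∷ v) (eq , ps ∷ qs) =
  unzip u v (suc-injective eq) ps ∷ sameRelativeOrder⇒≈ u v (suc-injective eq , qs)
  where
  unzip : ∀ u v → length u ≡ length v →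
          All (λ (a , b) → (x < a) ⇔ (y < b)) (zip u v) → OrderAgrees x y u v
  unzip []      []      _  []       = []
  unzip (_ ∷ u) (_ ∷ v) eq (p ∷ ps) = p ∷ unzip u v (suc-injective eq) ps

≈⇒sameRelativeOrder : u ≈ v → SameRelativeOrder u v
≈⇒sameRelativeOrder []       = refl , []
≈⇒sameRelativeOrder (ps ∷ e) with eq , qs ← ≈⇒sameRelativeOrder e = cong suc eq , toZip ps ∷ qs
  where
  toZip : OrderAgrees x y u v → All (λ (a , b) → (x < a) ⇔ (y < b)) (zip u v)
  toZip []       = []
  toZip (p ∷ ps) = p ∷ toZip ps

≈-length : u ≈ v → length u ≡ length v
≈-length []      = refl
≈-length (_ ∷ e) = cong suc (≈-length e)

≈-sym : u ≈ v → v ≈ u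
≈-sym []       = []
≈-sym (ps ∷ e) = Pointwise.symmetric (λ e → mk⇔ (Equivalence.from e) (Equivalence.to e)) ps ∷ ≈-sym e

≈-trans : u ≈ v → v ≈ w → u ≈ w
≈-trans []       []       = []
≈-trans (ps ∷ e) (qs ∷ f) =
  Pointwise.transitive
    (λ e f → mk⇔ (Equivalence.to f ∘ Equivalence.to e) (Equivalence.from e ∘ Equivalence.from f))
    ps qs ∷ ≈-trans e f

≈-shift : ∀ c u → u ≈ List.map (c +_) u
≈-shift c []      = []
≈-shift c (x ∷ u) = agrees u ∷ ≈-shift c u
  where
  agrees : ∀ u → OrderAgrees x (c + x) u (List.map (c +_) u)
  agrees []      = []
  agrees (_ ∷ u) = mk⇔ (+-monoʳ-< c) (+-cancelˡ-< c _ _) ∷ agrees u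

CrossAgrees : (u₁ u₂ v₁ v₂ : List ℕ) → Set
CrossAgrees u₁ u₂ v₁ v₂ = Pointwise (λ a b → OrderAgrees a b u₂ v₂) u₁ v₁

≈-++⁺ : u₁ ≈ v₁ → u₂ ≈ v₂ → CrossAgrees u₁ u₂ v₁ v₂ → u₁ ++ u₂ ≈ v₁ ++ v₂
≈-++⁺ []       f []       = f
≈-++⁺ (ps ∷ e) f (c ∷ cs) = Pointwise.++⁺ ps c ∷ ≈-++⁺ e f cs

≈-++⁻-agrees : u₁ ≈ v₁ → OrderAgrees x y (u₁ ++ u₂) (v₁ ++ v₂) →
               OrderAgrees x y u₁ v₁ × OrderAgrees x y u₂ v₂
≈-++⁻-agrees []      ps       = [] , ps
≈-++⁻-agrees (_ ∷ e) (p ∷ ps) with qs , rs ← ≈-++⁻-agrees e ps = p ∷ qs , rs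

≈-++⁻ : ∀ u₁ → u₁ ++ u₂ ≈ v →
        ∃₂ λ v₁ v₂ → v ≡ v₁ ++ v₂ × u₁ ≈ v₁ × u₂ ≈ v₂ × CrossAgrees u₁ u₂ v₁ v₂
≈-++⁻ []       e        = [] , _ , refl , [] , e , []
≈-++⁻ (x ∷ u₁) (ps ∷ e)
  with v₁ , v₂ , refl , e₁ , e₂ , cs ← ≈-++⁻ u₁ e
  with ps₁ , ps₂ ← ≈-++⁻-agrees e₁ ps
  = _ ∷ v₁ , v₂ , refl , ps₁ ∷ e₁ , e₂ , ps₂ ∷ cs
infix 4 _≪_

_≪_ : List ℕ → List ℕ → Set
u ≪ v = All (λ a → All (a <_) v) u

≪-resp-⊆ : u₁ ⊆ v₁ → u₂ ⊆ v₂ → v₁ ≪ v₂ → u₁ ≪ u₂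
≪-resp-⊆ s t = All.map (All-resp-⊆ t) ∘ All-resp-⊆ s

≪⇒crossAgrees : length u₁ ≡ length v₁ → length u₂ ≡ length v₂ →
                u₁ ≪ u₂ → v₁ ≪ v₂ → CrossAgrees u₁ u₂ v₁ v₂
≪⇒crossAgrees eq₁ eq₂ =
  All-Pointwise (All-Pointwise (λ a<c b<d → mk⇔ (λ _ → b<d) (λ _ → a<c)) eq₂) eq₁

≪-resp-crossAgrees : CrossAgrees u₁ u₂ v₁ v₂ → u₁ ≪ u₂ → v₁ ≪ v₂
≪-resp-crossAgrees = Pointwise-All (Pointwise-All Equivalence.to)

-- Containment of words

infix 4 _⊒_ _⊒?_

-- Pieces of patterns and shifted blocks are words that need not be permutations. The definition
-- unfolds exactly as `_Contains_` does, so `σ Contains π` is `word σ ⊒ word π` by computation.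
_⊒_ : List ℕ → List ℕ → Set
w ⊒ p = ∃ λ u → u ⊆ w × SameRelativeOrder u p

_⊒?_ : ∀ w p → Dec (w ⊒ p)
w ⊒? p = anySublist? (λ u → sameRelativeOrder? u p) w

⊒⁺ : u ⊆ w → u ≈ p → w ⊒ p
⊒⁺ s e = _ , s , ≈⇒sameRelativeOrder e

⊒⁻ : w ⊒ p → ∃ λ u → u ⊆ w × u ≈ p
⊒⁻ {p = p} (u , s , e) = u , s , sameRelativeOrder⇒≈ u p e

⊒-respʳ-≈ : p₁ ≈ p₂ → w ⊒ p₁ → w ⊒ p₂
⊒-respʳ-≈ f h with u , s , e ← ⊒⁻ h = ⊒⁺ s (≈-trans e f)

⊒-respˡ-⊆ : v ⊆ w → v ⊒ p → w ⊒ p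
⊒-respˡ-⊆ t (u , s , e) = u , ⊆-trans s t , e

⊒-shift⁺ : ∀ c → w ⊒ p → List.map (c +_) w ⊒ p
⊒-shift⁺ c h with u , s , e ← ⊒⁻ h = ⊒⁺ (⊆-map⁺ (c +_) s) (≈-trans (≈-sym (≈-shift c u)) e)

⊒-shift⁻ : ∀ c w → List.map (c +_) w ⊒ p → w ⊒ p
⊒-shift⁻ c w h with u , s , e ← ⊒⁻ h with v , refl , t ← ⊆-map⁻ (c +_) w s =
  ⊒⁺ t (≈-trans (≈-shift c v) e)

⊒-++⁺ : w ≪ v → p₁ ≪ p₂ → w ⊒ p₁ → v ⊒ p₂ → w ++ v ⊒ p₁ ++ p₂
⊒-++⁺ c d h k with u₁ , s₁ , e₁ ← ⊒⁻ h | u₂ , s₂ , e₂ ← ⊒⁻ k =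
  ⊒⁺ (⊆-++⁺ s₁ s₂)
     (≈-++⁺ e₁ e₂ (≪⇒crossAgrees (≈-length e₁) (≈-length e₂) (≪-resp-⊆ s₁ s₂ c) d))

-- An occurrence splits at the boundary between `w` and `v`. All its comparisons across the boundary
-- are ascents, and order agreement carries them to the pattern; the resulting `p₁ ≪ p₂` is what
-- later restricts the possible cuts.
⊒-++⁻ : ∀ w → w ≪ v → w ++ v ⊒ p →
        ∃₂ λ p₁ p₂ → p ≡ p₁ ++ p₂ × p₁ ≪ p₂ × w ⊒ p₁ × v ⊒ p₂
⊒-++⁻ w c h
  with u , s , e ← ⊒⁻ h
  with u₁ , u₂ , refl , s₁ , s₂ ← ⊆-++⁻ w s
  with p₁ , p₂ , refl , e₁ , e₂ , d ← ≈-++⁻ u₁ e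
  = p₁ , p₂ , refl , ≪-resp-crossAgrees d (≪-resp-⊆ s₁ s₂ c) , ⊒⁺ s₁ e₁ , ⊒⁺ s₂ e₂

⊒-prefix : ∀ p₁ → w ⊒ p₁ ++ p₂ → w ⊒ p₁
⊒-prefix p₁ h
  with u , s , e ← ⊒⁻ h
  with u₁ , u₂ , refl , e₁ , _ ← ≈-++⁻ p₁ (≈-sym e)
  = ⊒⁺ (⊆-trans (++⁺ʳ u₂ ⊆-refl) s) (≈-sym e₁)

⊒-suffix : ∀ p₁ → w ⊒ p₁ ++ p₂ → w ⊒ p₂
⊒-suffix p₁ h
  with u , s , e ← ⊒⁻ h
  with u₁ , u₂ , refl , _ , e₂ , _ ← ≈-++⁻ p₁ (≈-sym e)
  = ⊒⁺ (⊆-trans (++⁺ˡ u₁ ⊆-refl) s) (≈-sym e₂)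

-- `word (π *)` computes to `star (word π)`: the offsets of its two blocks reduce to 1 and 0.
star : List ℕ → List ℕ
star w = List.map suc w ++ 1 ∷ []

All-1< : All (1 ≤_) w → All (1 <_) (List.map suc w)
All-1< = All.map⁺ ∘ All.map s≤s

-- The last letter of star v is its least one, so it can only play the role of a least last letter.
star-⊒⁻ : ∀ v {x} → All (1 ≤_) v → star v ⊒ p₁ ++ x ∷ [] →
           v ⊒ p₁ ++ x ∷ [] ⊎ (v ⊒ p₁ × All (λ a → ¬ a < x) p₁)
star-⊒⁻ {p₁ = p₁} v {x} pos h
  with u , s , e ← ⊒⁻ h
  with ⊆-++⁻ (List.map suc v) s
... | u₁ , [] , refl , s₁ , _ = inj₁ (⊒-shift⁻ 1 v (⊒⁺ s₁ (subst (_≈ _) (++-identityʳ u₁) e)))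
... | u₁ , _ ∷ _ , refl , s₁ , (refl ∷ t) with refl ← ⊆-[] t
    with ≈-++⁻ u₁ e
... | p₁′ , .(_ ∷ []) , eq , e₁ , (_∷_ {y = z} _ []) , d
    with refl , refl ← ∷ʳ-injective p₁ p₁′ eq
    = inj₂ ( ⊒-shift⁻ 1 v (⊒⁺ s₁ e₁)
           , Pointwise-All (λ { (q ∷ []) 1<a b<x → <-asym 1<a (Equivalence.from q b<x) }) d
               (All-resp-⊆ s₁ (All-1< pos)))
star-⊒⁻ v pos h | u₁ , _ ∷ _ , refl , s₁ , (_ ∷ʳ ())

star-⊒⁺ : v ⊒ p → star v ⊒ p
star-⊒⁺ {v} h = ⊒-respˡ-⊆ (++⁺ʳ _ ⊆-refl) (⊒-shift⁺ 1 h)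

star-⊒-star⁺ : v ⊒ p → star v ⊒ star p
star-⊒-star⁺ {v} {p} h with u , s , e ← ⊒⁻ h =
  ⊒⁺ (⊆-++⁺ (⊆-map⁺ suc s) (refl ∷ []))
     (≈-++⁺ (≈-trans (≈-sym (≈-shift 1 u)) (≈-trans e (≈-shift 1 p))) ([] ∷ [])
       (All-Pointwise {P = λ a → ¬ a < 1} {Q = λ a → ¬ a < 1}
         (λ a≮1 b≮1 → mk⇔ (⊥-elim ∘ a≮1) (⊥-elim ∘ b≮1) ∷ [])
         (trans (length-map suc u) (trans (≈-length e) (sym (length-map suc p))))
         (≮1 u) (≮1 p)))
  where
  ≮1 : ∀ u → All (λ a → ¬ a < 1) (List.map suc u)
  ≮1 u = All.map⁺ (All.tabulate λ { _ (s≤s ()) })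

-- Whether or not the occurrence uses the final 1 of `star v`, dropping its last letter leaves an
-- occurrence of the raised `p` inside `v`.
star-⊒-star⁻ : ∀ v → All (1 ≤_) v → star v ⊒ star p → v ⊒ p
star-⊒-star⁻ {p} v pos h with star-⊒⁻ v pos h
... | inj₁ k       = ⊒-respʳ-≈ (≈-sym (≈-shift 1 p)) (⊒-prefix (List.map suc p) k)
... | inj₂ (k , _) = ⊒-respʳ-≈ (≈-sym (≈-shift 1 p)) k

-- Direct sums

positive : ∀ σ → All (1 ≤_) (word σ)
positive = All.map proj₁ ∘ proj₁ ∘ word-isPermutation

bounded : ∀ σ → All (_≤ size σ) (word σ)
bounded = All.map proj₂ ∘ proj₁ ∘ word-isPermutation

glue : 𝔖 → 𝔖 → 𝔖
glue σ₁ σ₂ = inflate p213 (σ₁ ∷ p1 ∷ σ₂ ∷ [])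

word-glue : ∀ σ₁ σ₂ → word (glue σ₁ σ₂) ≡ word (σ₁ *) ++ List.map (size (σ₁ *) +_) (word σ₂)
word-glue σ₁ σ₂ = trans (sym (++-assoc (List.map suc (word σ₁)) [ 1 ] _))
  (cong (word (σ₁ *) ++_) (trans (++-identityʳ _)
    (cong (λ c → List.map (c +_) (word σ₂)) (sym (size-* σ₁)))))
  where
  size-* : ∀ σ → size (σ *) ≡ size σ + 1
  size-* σ = trans (length-++ (List.map suc (word σ))) (cong (_+ 1) (length-map suc (word σ)))

blocks-≪ : ∀ σ₁ w → All (1 ≤_) w → word σ₁ ≪ List.map (size σ₁ +_) w
blocks-≪ σ₁ w pos =
  All.map (λ x≤ → All.map⁺ (All.map (λ 1≤y → ≤-<-trans x≤ (m<m+n _ 1≤y)) pos)) (bounded σ₁)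

-- The direct sum with all values raised by `o`. Carrying the offset makes a suffix of a sum again
-- such a sum, and `⨁-offset` forgets it up to order isomorphism.
⨁ : ℕ → List 𝔖 → List ℕ
⨁ o []       = []
⨁ o (ρ ∷ ρs) = List.map (o +_) (word ρ) ++ ⨁ (o + size ρ) ρs

total : List 𝔖 → ℕ
total = sum ∘ List.map size

⨁-++ : ∀ o ρs τs → ⨁ o (ρs ++ τs) ≡ ⨁ o ρs ++ ⨁ (o + total ρs) τs
⨁-++ o []       τs = cong (λ c → ⨁ c τs) (sym (+-identityʳ o))
⨁-++ o (ρ ∷ ρs) τs = trans
  (cong (List.map (o +_) (word ρ) ++_) (trans (⨁-++ (o + size ρ) ρs τs)
    (cong (λ c → ⨁ (o + size ρ) ρs ++ ⨁ c τs) (+-assoc o (size ρ) (total ρs)))))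
  (sym (++-assoc (List.map (o +_) (word ρ)) (⨁ (o + size ρ) ρs) _))

⨁-shift : ∀ c o ρs → ⨁ (c + o) ρs ≡ List.map (c +_) (⨁ o ρs)
⨁-shift c o []       = refl
⨁-shift c o (ρ ∷ ρs) = sym (trans (map-++ (c +_) (List.map (o +_) (word ρ)) _)
  (cong₂ _++_
    (trans (sym (map-∘ (word ρ))) (map-cong (λ x → sym (+-assoc c o x)) (word ρ)))
    (trans (sym (⨁-shift c (o + size ρ) ρs)) (cong (λ d → ⨁ d ρs) (sym (+-assoc c o (size ρ)))))))

⨁-offset : ∀ o o′ ρs → ⨁ o ρs ≈ ⨁ o′ ρs
⨁-offset o o′ ρs = ≈-trans (≈-sym (zeroOffset o)) (zeroOffset o′)
  where
  zeroOffset : ∀ o → ⨁ 0 ρs ≈ ⨁ o ρs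
  zeroOffset o = subst (⨁ 0 ρs ≈_)
    (trans (sym (⨁-shift o 0 ρs)) (cong (λ c → ⨁ c ρs) (+-identityʳ o))) (≈-shift o (⨁ 0 ρs))

⨁-lower : ∀ o ρs → All (o <_) (⨁ o ρs)
⨁-lower o []       = []
⨁-lower o (ρ ∷ ρs) = All.++⁺
  (All.map⁺ (All.map (m<m+n o) (positive ρ)))
  (All.map (≤-<-trans (m≤m+n o (size ρ))) (⨁-lower (o + size ρ) ρs))

⨁-upper : ∀ o ρs → All (_≤ o + total ρs) (⨁ o ρs)
⨁-upper o []       = []
⨁-upper o (ρ ∷ ρs) = All.++⁺
  (All.map⁺ (All.map (λ x≤ → +-monoʳ-≤ o (≤-trans x≤ (m≤m+n (size ρ) (total ρs)))) (bounded ρ)))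
  (All.map (λ x≤ → ≤-trans x≤ (≤-reflexive (+-assoc o (size ρ) (total ρs)))) (⨁-upper (o + size ρ) ρs))

⨁-≪ : ∀ o ρs τs → ⨁ o ρs ≪ ⨁ (o + total ρs) τs
⨁-≪ o ρs τs = All.map (λ x≤ → All.map (≤-<-trans x≤) (⨁-lower (o + total ρs) τs)) (⨁-upper o ρs)

-- By `word-ι-*` this is the word of the pattern in the theorem; lists replace vectors because the
-- recursion passes to prefixes and suffixes.
stars : List 𝔖 → List ℕ
stars πs = ⨁ 0 (List.map _* πs)

∷ʳ-≡-++⇒last∈ : ∀ (v : List A) {m z zs} us → v ++ [ m ] ≡ us ++ z ∷ zs → m ∈ z ∷ zs
∷ʳ-≡-++⇒last∈ v       {m = m} []       eq = subst (m ∈_) eq (∈-++⁺ʳ v (here refl))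
∷ʳ-≡-++⇒last∈ []          (_ ∷ us) eq with () ← ++-conicalʳ us _ (sym (proj₂ (∷-injective eq)))
∷ʳ-≡-++⇒last∈ (_ ∷ v)     (_ ∷ us) eq = ∷ʳ-≡-++⇒last∈ v us (proj₂ (∷-injective eq))

-- For a block ending in `m` and cut into two nonempty pieces, this locates the two letters whose
-- comparison refutes the cut in `⨁-cut`.
∷ʳ-≡-∷-++⇒∈ : ∀ (v : List A) {m x z zs} us → v ++ [ m ] ≡ x ∷ us ++ z ∷ zs → x ∈ v × m ∈ z ∷ zs
∷ʳ-≡-∷-++⇒∈ []      us eq with () ← ++-conicalʳ us _ (sym (proj₂ (∷-injective eq)))
∷ʳ-≡-∷-++⇒∈ (_ ∷ v) us eq = here (sym (proj₁ (∷-injective eq))) , ∷ʳ-≡-++⇒last∈ v us (proj₂ (∷-injective eq))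

-- A cut strictly inside a block is impossible because the last letter of a block is its least one.
⨁-cut : ∀ o πs p₁ → ⨁ o (List.map _* πs) ≡ p₁ ++ p₂ → p₁ ≪ p₂ →
        ∃ λ j → j ≤ length πs × p₁ ≡ ⨁ o (List.map _* (take j πs)) ×
        ∃ λ o′ → p₂ ≡ ⨁ o′ (List.map _* (drop j πs))
⨁-cut o πs       []       eq cross = 0 , z≤n , refl , o , sym eq
⨁-cut o (π ∷ πs) (x ∷ p₁) eq cross
  with ++-≡-++ (List.map (o +_) (word (π *))) (x ∷ p₁) eq
... | inj₁ (p₁′ , eq₁ , eq₂) with
      j , j≤ , q₁ , o′ , q₂ ← ⨁-cut (o + size (π *)) πs p₁′ eq₂
        (All.++⁻ʳ (List.map (o +_) (word (π *))) (subst (_≪ _) eq₁ cross))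
    = suc j , s≤s j≤ , trans eq₁ (cong (List.map (o +_) (word (π *)) ++_) q₁) , o′ , q₂
... | inj₂ (z , zs , eq₁ , refl)
    with x∈ , m∈ ← ∷ʳ-≡-∷-++⇒∈ (List.map (o +_) (List.map suc (word π))) p₁
                     (trans (sym (map-++ (o +_) (List.map suc (word π)) [ 1 ])) eq₁)
    = ⊥-elim (<-asym (All.lookup (All.head cross) (∈-++⁺ˡ m∈)) (All.lookup aboveLast x∈))
  where
  aboveLast : All (o + 1 <_) (List.map (o +_) (List.map suc (word π)))
  aboveLast = All.map⁺ (All.map (+-monoʳ-< o) (All-1< (positive π)))

-- Supplies the shape `p ++ [ x ]` that `star-⊒⁻` asks for. Taken with the size of an earlier
-- summand as offset, the bound places `x` above that summand.
last-stars : ∀ o π πs → ∃₂ λ p x → ⨁ o (List.map _* (π ∷ πs)) ≡ p ++ [ x ] × o < x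
last-stars o π [] =
  List.map (o +_) (List.map suc (word π)) , o + 1 ,
  trans (++-identityʳ _) (map-++ (o +_) (List.map suc (word π)) [ 1 ]) , m<m+n o z<s
last-stars o π (ρ ∷ πs) with p , x , eq , o′<x ← last-stars (o + size (π *)) ρ πs =
  List.map (o +_) (word (π *)) ++ p , x ,
  trans (cong (List.map (o +_) (word (π *)) ++_) eq) (sym (++-assoc (List.map (o +_) (word (π *))) p [ x ])) ,
  ≤-<-trans (m≤m+n o _) o′<x

-- The last letter of the pattern belongs to a summand after `π *`, so it exceeds the 1 in `π *` and
-- cannot be played by the final 1 of `σ *`.
star-⊒-stars⁻ : ∀ σ π ρ πs → word (σ *) ⊒ stars (π ∷ ρ ∷ πs) → word σ ⊒ stars (π ∷ ρ ∷ πs)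
star-⊒-stars⁻ σ π ρ πs h
  with p , x , eq , o<x ← last-stars (size (π *)) ρ πs
  with eq′ ← trans (cong (List.map (0 +_) (word (π *)) ++_) eq)
                   (sym (++-assoc (List.map (0 +_) (word (π *))) p [ x ]))
  with star-⊒⁻ (word σ) (positive σ) (subst (word (σ *) ⊒_) eq′ h)
... | inj₁ k       = subst (word σ ⊒_) (sym eq′) k
... | inj₂ (_ , ≮) = ⊥-elim (All.lookup ≮ 1∈ (≤-<-trans 1≤size o<x))
  where
  1∈ : 1 ∈ List.map (0 +_) (word (π *)) ++ p
  1∈ = ∈-++⁺ˡ (∈-map⁺ (0 +_) {1} (∈-++⁺ʳ (List.map suc (word π)) (here refl)))
  1≤size : 1 ≤ size (π *)
  1≤size = All.lookup (bounded (π *)) (∈-++⁺ʳ (List.map suc (word π)) (here refl))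

-- A lone summand can use the final 1 of `σ *` as its own least letter, so the two stars cancel and
-- the pattern of the hypothesis remains.
⊒-stars-singleton : ∀ σ π → (word (σ *) ⊒ stars (π ∷ [])) ⇔ (σ Contains π)
⊒-stars-singleton σ π = mk⇔
  (star-⊒-star⁻ (word σ) (positive σ) ∘ subst (word (σ *) ⊒_) eq)
  (subst (word (σ *) ⊒_) (sym eq) ∘ star-⊒-star⁺)
  where
  eq : stars (π ∷ []) ≡ word (π *)
  eq = trans (++-identityʳ _) (map-id _)

⊒-stars-∷∷ : ∀ σ π ρ πs → (word (σ *) ⊒ stars (π ∷ ρ ∷ πs)) ⇔ (word σ ⊒ stars (π ∷ ρ ∷ πs))
⊒-stars-∷∷ σ π ρ πs = mk⇔ (star-⊒-stars⁻ σ π ρ πs) star-⊒⁺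

stars-split : ∀ πs j →
  stars πs ≡ stars (take j πs) ++ ⨁ (total (List.map _* (take j πs))) (List.map _* (drop j πs))
stars-split πs j = trans
  (cong (⨁ 0) (trans (cong (List.map _*) (sym (take++drop≡id j πs))) (map-++ _* (take j πs) (drop j πs))))
  (⨁-++ 0 (List.map _* (take j πs)) (List.map _* (drop j πs)))

glue-⊒ : ∀ σ₁ σ₂ πs → (word (glue σ₁ σ₂) ⊒ stars πs) ⇔
  (∃ λ j → j ≤ length πs × word (σ₁ *) ⊒ stars (take j πs) × word σ₂ ⊒ stars (drop j πs))
glue-⊒ σ₁ σ₂ πs = mk⇔ to from
  where
  to : _ → _
  to h with p₁ , p₂ , eq , cross , h₁ , h₂ ← ⊒-++⁻ (word (σ₁ *)) (blocks-≪ (σ₁ *) (word σ₂) (positive σ₂))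
                                      (subst (_⊒ stars πs) (word-glue σ₁ σ₂) h)
       with j , j≤ , refl , o , refl ← ⨁-cut 0 πs p₁ eq cross
    = j , j≤ , h₁ , ⊒-respʳ-≈ (⨁-offset o 0 (List.map _* (drop j πs))) (⊒-shift⁻ (size (σ₁ *)) (word σ₂) h₂)
  from : _ → _
  from (j , _ , h₁ , h₂) = subst₂ _⊒_ (sym (word-glue σ₁ σ₂)) (sym (stars-split πs j))
    (⊒-++⁺ (blocks-≪ (σ₁ *) (word σ₂) (positive σ₂))
      (⨁-≪ 0 (List.map _* (take j πs)) (List.map _* (drop j πs))) h₁
      (⊒-shift⁺ (size (σ₁ *)) (⊒-respʳ-≈ (⨁-offset 0 _ (List.map _* (drop j πs))) h₂)))

⊒-stars-take : ∀ w πs j → w ⊒ stars (take (suc j) πs) → w ⊒ stars (take j πs)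
⊒-stars-take w πs j h = subst (λ ρs → w ⊒ stars ρs) (take-take πs j)
  (⊒-prefix (stars (take j (take (suc j) πs))) (subst (w ⊒_) (stars-split (take (suc j) πs) j) h))
  where
  take-take : ∀ (πs : List 𝔖) j → take j (take (suc j) πs) ≡ take j πs
  take-take πs       zero    = refl
  take-take []       (suc j) = refl
  take-take (π ∷ πs) (suc j) = cong (π ∷_) (take-take πs j)

⊒-stars-drop : ∀ w πs j → w ⊒ stars (drop j πs) → w ⊒ stars (drop (suc j) πs)
⊒-stars-drop w []       zero    h = h
⊒-stars-drop w (π ∷ πs) zero    h =
  ⊒-respʳ-≈ (⨁-offset _ 0 (List.map _* πs)) (⊒-suffix (List.map (0 +_) (word (π *))) h)
⊒-stars-drop w []       (suc j) h = h
⊒-stars-drop w (π ∷ πs) (suc j) h = ⊒-stars-drop w πs j h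

-- Inflations of the identity as direct sums

offset-initial : ∀ pre bs {t} → All (λ b → proj₁ b < t) pre → All (λ b → ¬ proj₁ b < t) bs →
                 offset (pre ++ bs) t ≡ totalSize pre
offset-initial pre bs {t} below notBelow = cong totalSize
  (trans (filter-++ <t? pre bs)
    (trans (cong₂ _++_ (filter-all <t? below) (filter-none <t? notBelow)) (++-identityʳ pre)))
  where <t? = λ b → proj₁ b <? t

-- Offsets are computed from the whole list of blocks, so the induction keeps the blocks already
-- passed in `pre`. With increasing labels, `pre` consists exactly of the blocks below the current
-- one.
increasing-blocks : ∀ pre bs →
  All (λ b → All (λ c → proj₁ b < proj₁ c) bs) pre → AllPairs (λ b c → proj₁ b < proj₁ c) bs →
  concatMap (block (pre ++ bs)) bs ≡ ⨁ (totalSize pre) (List.map proj₂ bs)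
increasing-blocks pre []             _     _          = refl
increasing-blocks pre (b@(t , σ) ∷ bs) below (t< ∷ inc) = cong₂ _++_
  (cong (λ o → List.map (o +_) (word σ))
    (offset-initial pre (b ∷ bs) (All.map All.head below) (<-irrefl refl ∷ All.map <-asym t<)))
  (trans (cong (λ cs → concatMap (block cs) bs) (sym (++-assoc pre [ b ] bs)))
    (trans (increasing-blocks (pre ++ [ b ]) bs (All.++⁺ (All.map All.tail below) (t< ∷ [])) inc)
      (cong (λ o → ⨁ o (List.map proj₂ bs)) totalSize-∷ʳ)))
  where
  totalSize-∷ʳ : totalSize (pre ++ [ b ]) ≡ totalSize pre + size σ
  totalSize-∷ʳ = trans (cong sum (map-++ (size ∘ proj₂) pre [ b ]))
    (trans (sum-++ (List.map (size ∘ proj₂) pre) [ size σ ]) (cong (totalSize pre +_) (+-identityʳ (size σ))))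

zip-above : ∀ (f : ℕ → ℕ) {t} r (σs : List 𝔖) → (∀ i → t < f i) →
            All (λ c → t < proj₁ c) (zip (applyUpTo f r) σs)
zip-above f zero    σs       t< = []
zip-above f (suc r) []       t< = []
zip-above f (suc r) (σ ∷ σs) t< = t< 0 ∷ zip-above (f ∘ suc) r σs (t< ∘ suc)

zip-increasing : ∀ (f : ℕ → ℕ) r (σs : List 𝔖) → (∀ {i j} → i < j → f i < f j) →
                 AllPairs (λ b c → proj₁ b < proj₁ c) (zip (applyUpTo f r) σs)
zip-increasing f zero    σs       mono = []
zip-increasing f (suc r) []       mono = []
zip-increasing f (suc r) (σ ∷ σs) mono =
  zip-above (f ∘ suc) r σs (λ i → mono z<s) ∷ zip-increasing (f ∘ suc) r σs (mono ∘ s≤s)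

map-proj₂-zip : ∀ (xs : List A) (ys : List B) → length xs ≡ length ys → List.map proj₂ (zip xs ys) ≡ ys
map-proj₂-zip []       []       _  = refl
map-proj₂-zip (_ ∷ xs) (y ∷ ys) eq = cong (y ∷_) (map-proj₂-zip xs ys (suc-injective eq))

word-ι : ∀ {r} (σs : Vec 𝔖 r) → word ι[ σs ] ≡ ⨁ 0 (toList σs)
word-ι {r} σs = trans
  (cong (λ τs → inflateWord (zip (applyUpTo suc r) τs)) (toList-cast _ σs))
  (trans (increasing-blocks [] _ [] (zip-increasing suc r (toList σs) s≤s))
    (cong (⨁ 0) (map-proj₂-zip (applyUpTo suc r) (toList σs)
      (trans (length-applyUpTo suc r) (sym (length-toList σs))))))

word-ι-* : ∀ {r} (πs : Vec 𝔖 r) → word ι[ map _* πs ] ≡ stars (toList πs)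
word-ι-* πs = trans (word-ι (map _* πs)) (cong (⨁ 0) (toList-map _* πs))

-- Enumeration of permutations

word-injective : word σ ≡ word τ → σ ≡ τ
word-injective {mk𝔖 _ _} {mk𝔖 _ _} refl = refl

∈-wordsOver⁺ : ∀ {as} w → All (_∈ as) w → w ∈ wordsOver as (length w)
∈-wordsOver⁺ []      []       = here refl
∈-wordsOver⁺ (x ∷ w) (x∈ ∷ w∈) = ∈-cartesianProductWith⁺ _∷_ x∈ (∈-wordsOver⁺ w w∈)

∈-wordsOver⁻ : ∀ as l → w ∈ wordsOver as l → length w ≡ l
∈-wordsOver⁻ as zero    (here refl) = refl
∈-wordsOver⁻ as (suc l) w∈
  with _ , _ , _ , v∈ , refl ← ∈-cartesianProductWith⁻ _∷_ as (wordsOver as l) w∈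
  = cong suc (∈-wordsOver⁻ as l v∈)

wordsOver-unique : ∀ {as} l → Unique as → Unique (wordsOver as l)
wordsOver-unique zero    as! = [] ∷ []
wordsOver-unique (suc l) as! = Unique.cartesianProductWith⁺ _∷_ ∷-injective as! (wordsOver-unique l as!)

-- Turns the partial map into a filter of words, through which uniqueness and membership for
-- `permutations` are read off.
map-word-mapMaybe : ∀ ws → List.map word (mapMaybe toPermutation ws) ≡ filter isPermutation? ws
map-word-mapMaybe []       = refl
map-word-mapMaybe (w ∷ ws) with isPermutation? w
... | yes w-perm = trans (cong (w ∷_) (map-word-mapMaybe ws)) (sym (filter-accept isPermutation? w-perm))
... | no ¬w-perm = trans (map-word-mapMaybe ws) (sym (filter-reject isPermutation? ¬w-perm))

permutations-unique : ∀ n → Unique (permutations n)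
permutations-unique n = Unique.map⁻ {f = word} (subst Unique
  (sym (map-word-mapMaybe (wordsOver (applyUpTo suc n) n)))
  (Unique.filter⁺ isPermutation? (wordsOver-unique n
    (Unique.applyUpTo⁺₁ suc n (λ i<j _ → <⇒≢ i<j ∘ suc-injective)))))

letters-∈ : ∀ σ → All (_∈ applyUpTo suc (size σ)) (word σ)
letters-∈ σ = All.map (λ { {suc x} (_ , x≤) → ∈-applyUpTo⁺ suc x≤ }) (proj₁ (word-isPermutation σ))

∈-permutations⁺ : ∀ σ → σ ∈ permutations (size σ)
∈-permutations⁺ σ
  with τ , τ∈ , eq ← ∈-map⁻ word (subst (word σ ∈_)
                       (sym (map-word-mapMaybe (wordsOver (applyUpTo suc (size σ)) (size σ))))
                       (∈-filter⁺ isPermutation? (∈-wordsOver⁺ (word σ) (letters-∈ σ)) (word-isPermutation σ)))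
  = subst (_∈ permutations (size σ)) (sym (word-injective eq)) τ∈

∈-permutations⁻ : ∀ n → σ ∈ permutations n → size σ ≡ n
∈-permutations⁻ {σ} n σ∈ = ∈-wordsOver⁻ (applyUpTo suc n) n
  (proj₁ (∈-filter⁻ isPermutation? {xs = wordsOver (applyUpTo suc n) n}
    (subst (word σ ∈_) (map-word-mapMaybe (wordsOver (applyUpTo suc n) n)) (∈-map⁺ word σ∈))))

avoiders : ℕ → List 𝔖
avoiders n = 𝔖[ n , p312 ∷ [] ]

avoiders-unique : ∀ n → Unique (avoiders n)
avoiders-unique n = Unique.filter⁺ (_avoids? (p312 ∷ [])) (permutations-unique n)

∈-avoiders⁺ : σ Avoids (p312 ∷ []) → σ ∈ avoiders (size σ)
∈-avoiders⁺ {σ} av = ∈-filter⁺ (_avoids? (p312 ∷ [])) (∈-permutations⁺ σ) av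

∈-avoiders⁻ : ∀ n → σ ∈ avoiders n → size σ ≡ n × σ Avoids (p312 ∷ [])
∈-avoiders⁻ n σ∈ with σ∈′ , av ← ∈-filter⁻ (_avoids? (p312 ∷ [])) {xs = permutations n} σ∈ =
  ∈-permutations⁻ n σ∈′ , av

-- Pigeonhole

unique-⊆⇒length-≤ : ∀ {xs ys : List A} → Unique xs → (∀ {x} → x ∈ xs → x ∈ ys) → length xs ≤ length ys
unique-⊆⇒length-≤ []           _  = z≤n
unique-⊆⇒length-≤ {xs = x ∷ xs} (x∉ ∷ xs!) f with ys₁ , ys₂ , refl ← ∈-∃++ (f (here refl)) = begin
  suc (length xs)                ≤⟨ s≤s (unique-⊆⇒length-≤ xs! g) ⟩
  suc (length (ys₁ ++ ys₂))      ≡⟨ cong suc (length-++ ys₁) ⟩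
  suc (length ys₁ + length ys₂)  ≡⟨ +-suc (length ys₁) (length ys₂) ⟨
  length ys₁ + suc (length ys₂)  ≡⟨ length-++ ys₁ ⟨
  length (ys₁ ++ x ∷ ys₂)        ∎
  where
  open ≤-Reasoning
  g : ∀ {y} → y ∈ xs → y ∈ ys₁ ++ ys₂
  g y∈ with ∈-++⁻ ys₁ (f (there y∈))
  ... | inj₁ y∈₁          = ∈-++⁺ˡ y∈₁
  ... | inj₂ (here refl)  = contradiction refl (All.lookup x∉ y∈)
  ... | inj₂ (there y∈₂)  = ∈-++⁺ʳ ys₁ y∈₂

-- Each use below is by contradiction: a missing or misplaced letter would force too many distinct
-- letters into an interval.
unique-interval : ∀ {lo hi w} → lo ≤ hi → Unique w → All (lo <_) w → All (_≤ hi) w → lo + length w ≤ hi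
unique-interval {lo} {hi} {w} lo≤hi w! above below = begin
  lo + length w                                    ≤⟨ +-monoʳ-≤ lo (unique-⊆⇒length-≤ w! interval) ⟩
  lo + length (applyUpTo (suc lo +_) (hi ∸ lo))    ≡⟨ cong (lo +_) (length-applyUpTo _ (hi ∸ lo)) ⟩
  lo + (hi ∸ lo)                                   ≡⟨ m+[n∸m]≡n lo≤hi ⟩
  hi                                               ∎
  where
  open ≤-Reasoning
  interval : ∀ {x} → x ∈ w → x ∈ applyUpTo (suc lo +_) (hi ∸ lo)
  interval {x} x∈ = subst (_∈ _) (m+[n∸m]≡n lo<x)
    (∈-applyUpTo⁺ (suc lo +_) (≤-trans (≤-reflexive (sym (+-∸-assoc 1 lo<x)))
      (∸-monoˡ-≤ lo (All.lookup below x∈))))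
    where lo<x = All.lookup above x∈

-- Decomposition of 312-avoiding permutations

contains-resp-glueˡ : ∀ σ₁ σ₂ → word σ₁ ⊒ p → word (glue σ₁ σ₂) ⊒ p
contains-resp-glueˡ σ₁ σ₂ h = subst (_⊒ _) (sym (word-glue σ₁ σ₂))
  (⊒-respˡ-⊆ (++⁺ʳ _ ⊆-refl) (star-⊒⁺ h))

contains-resp-glueʳ : ∀ σ₁ σ₂ → word σ₂ ⊒ p → word (glue σ₁ σ₂) ⊒ p
contains-resp-glueʳ σ₁ σ₂ h = subst (_⊒ _) (sym (word-glue σ₁ σ₂))
  (⊒-respˡ-⊆ (++⁺ˡ (word (σ₁ *)) ⊆-refl) (⊒-shift⁺ (size (σ₁ *)) h))

-- The pattern 312 is sum-indecomposable, so an occurrence in a direct sum stays within one summand.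
cut-312 : ∀ p₁ → 3 ∷ 1 ∷ 2 ∷ [] ≡ p₁ ++ p₂ → p₁ ≪ p₂ → p₁ ≡ 3 ∷ 1 ∷ 2 ∷ [] ⊎ p₂ ≡ 3 ∷ 1 ∷ 2 ∷ []
cut-312 []                  refl _ = inj₂ refl
cut-312 (_ ∷ [])            refl (((s≤s ()) ∷ _) ∷ _)
cut-312 (_ ∷ _ ∷ [])        refl ((s≤s (s≤s ()) ∷ _) ∷ _)
cut-312 (_ ∷ _ ∷ _ ∷ [])    refl _ = inj₁ refl
cut-312 (_ ∷ _ ∷ _ ∷ _ ∷ _) ()

glue-contains-312 : ∀ σ₁ σ₂ → glue σ₁ σ₂ Contains p312 → σ₁ Contains p312 ⊎ σ₂ Contains p312
glue-contains-312 σ₁ σ₂ h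
  with p₁ , p₂ , eq , cross , h₁ , h₂ ← ⊒-++⁻ (word (σ₁ *)) (blocks-≪ (σ₁ *) (word σ₂) (positive σ₂))
                                        (subst (_⊒ _) (word-glue σ₁ σ₂) h)
  with cut-312 p₁ eq cross
... | inj₂ refl = inj₂ (⊒-shift⁻ (size (σ₁ *)) (word σ₂) h₂)
... | inj₁ refl with star-⊒⁻ {p₁ = 3 ∷ 1 ∷ []} (word σ₁) (positive σ₁) h₁
...   | inj₁ k                = inj₁ k
-- The last letter 2 of 312 is not its least, so the final 1 of `σ₁ *` cannot play it.
...   | inj₂ (_ , _ ∷ 1≮2 ∷ _) = contradiction (s≤s (s≤s z≤n)) 1≮2

glue-avoids⁺ : σ Avoids (p312 ∷ []) → τ Avoids (p312 ∷ []) → glue σ τ Avoids (p312 ∷ [])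
glue-avoids⁺ {σ} {τ} (¬σ ∷ []) (¬τ ∷ []) =
  (λ h → case glue-contains-312 σ τ h of λ { (inj₁ k) → ¬σ k ; (inj₂ k) → ¬τ k }) ∷ []

glue-avoids⁻ : glue σ τ Avoids (p312 ∷ []) → σ Avoids (p312 ∷ []) × τ Avoids (p312 ∷ [])
glue-avoids⁻ {σ} {τ} (¬h ∷ []) =
  (¬h ∘ contains-resp-glueˡ σ τ ∷ []) , (¬h ∘ contains-resp-glueʳ σ τ ∷ [])

++-∷-injective : ∀ {x : A} us {vs ys zs} → x ∉ us → x ∉ vs →
                 us ++ x ∷ ys ≡ vs ++ x ∷ zs → us ≡ vs × ys ≡ zs
++-∷-injective []       {[]}     _   _   refl = refl , refl
++-∷-injective []       {_ ∷ _}  _   ∉vs eq   = contradiction (here (proj₁ (∷-injective eq))) ∉vs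
++-∷-injective (_ ∷ _)  {[]}     ∉us _   eq   = contradiction (here (sym (proj₁ (∷-injective eq)))) ∉us
++-∷-injective (_ ∷ us) {_ ∷ vs} ∉us ∉vs eq
  with refl , eq′ ← ∷-injective eq
  with refl , q ← ++-∷-injective us (∉us ∘ there) (∉vs ∘ there) eq′
  = refl , q

1∉map-suc : ∀ σ → 1 ∉ List.map suc (word σ)
1∉map-suc σ 1∈ = <-irrefl refl (All.lookup (All-1< (positive σ)) 1∈)

-- The first 1 in the word comes right after the raised letters of the left factor and so marks the
-- boundary.
glue-injective : glue σ π ≡ glue τ ρ → σ ≡ τ × π ≡ ρ
glue-injective {σ} {π} {τ} {ρ} eq
  with eq₁ , eq₂ ← ++-∷-injective (List.map suc (word σ)) (1∉map-suc σ) (1∉map-suc τ) (cong word eq)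
  with refl ← word-injective {σ} {τ} (map-injective suc-injective eq₁)
  = refl , word-injective (map-injective (+-cancelˡ-≡ (size σ + 1) _ _)
             (trans (sym (++-identityʳ _)) (trans eq₂ (++-identityʳ _))))

size-glue : ∀ σ τ → size (glue σ τ) ≡ suc (size σ + size τ)
size-glue σ τ = begin
  size (glue σ τ)                                     ≡⟨ cong length (word-glue σ τ) ⟩
  length (word (σ *) ++ List.map _ (word τ))          ≡⟨ length-++ (word (σ *)) ⟩
  length (word (σ *)) + length (List.map _ (word τ))
    ≡⟨ cong₂ _+_ (length-++ (List.map suc (word σ))) (length-map _ (word τ)) ⟩
  length (List.map suc (word σ)) + 1 + size τ         ≡⟨ cong (λ k → k + 1 + size τ) (length-map suc (word σ)) ⟩
  size σ + 1 + size τ                                 ≡⟨ cong (_+ size τ) (+-comm (size σ) 1) ⟩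
  suc (size σ + size τ)                               ∎
  where open ≡-Reasoning

Unique-++⁻ : ∀ (xs : List A) {ys} → Unique (xs ++ ys) →
             Unique xs × Unique ys × All (λ x → All (x ≢_) ys) xs
Unique-++⁻ []       ys!         = [] , ys! , []
Unique-++⁻ (x ∷ xs) (x∉ ∷ xys!) with xs! , ys! , d ← Unique-++⁻ xs xys! =
  All.++⁻ˡ xs x∉ ∷ xs! , ys! , All.++⁻ʳ xs x∉ ∷ d

unshift : ∀ c {w} → All (c <_) w → ∃ λ v → w ≡ List.map (c +_) v × All (1 ≤_) v
unshift c []                  = [] , refl , []
unshift c (_∷_ {x} c<x above) with v , refl , pos ← unshift c above =
  x ∸ c ∷ v , cong (_∷ _) (sym (m+[n∸m]≡n (<⇒≤ c<x))) , m<n⇒0<n∸m c<x ∷ pos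

shifted-isPermutation : ∀ c {w} → Unique w → All (c <_) w → All (_≤ c + length w) w →
                        ∃ λ v → w ≡ List.map (c +_) v × IsPermutation v
shifted-isPermutation c w! above below with v , refl , pos ← unshift c above =
  v , refl ,
  All.zip (pos , All.map (λ {x} c+x≤ → ≤-trans (+-cancelˡ-≤ c _ _ c+x≤) (≤-reflexive (length-map _ v)))
                         (All.map⁻ below)) ,
  Unique.map⁻ w!

module _ (σ : 𝔖) {n} (size-σ : size σ ≡ suc n) where

  1∈word : 1 ∈ word σ
  1∈word with 1 ∈? word σ
  ... | yes 1∈ = 1∈
  ... | no 1∉  = contradiction
    (unique-interval {1} {size σ} (≤-trans (s≤s z≤n) (≤-reflexive (sym size-σ))) (proj₂ (word-isPermutation σ))
      (All.tabulate λ x∈ → ≤∧≢⇒< (All.lookup (positive σ) x∈) λ { refl → 1∉ x∈ }) (bounded σ))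
    (<-irrefl refl)

  -- Cut at the letter 1. A descent from a letter before it to a letter after it would form a 312
  -- with the 1 in between, so `us ≪ vs`; counting then forces `us` to fill the values from 2 to
  -- `1 + k` and `vs` those above.
  unglue : σ Avoids (p312 ∷ []) → ∃₂ λ σ₁ σ₂ → σ ≡ glue σ₁ σ₂
  unglue (avoids ∷ [])
    with us , vs , eq ← ∈-∃++ 1∈word
    with all-bounds , w! ← subst IsPermutation eq (word-isPermutation σ)
    with us! , 1∉vs ∷ vs! , d ← Unique-++⁻ us w!
    = mk𝔖 (proj₁ left) (proj₂ (proj₂ left)) , mk𝔖 (proj₁ right) (proj₂ (proj₂ right)) ,
      word-injective (trans eq word-≡)
    where
    k = length us

    us>1 : All (1 <_) us
    us>1 = All.zipWith (λ ((1≤x , _) , x≢) → ≤∧≢⇒< 1≤x (All.head x≢ ∘ sym)) (All.++⁻ˡ us all-bounds , d)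

    vs>1 : All (1 <_) vs
    vs>1 = All.zipWith (λ ((1≤x , _) , 1≢x) → ≤∧≢⇒< 1≤x 1≢x) (All.tail (All.++⁻ʳ us all-bounds) , 1∉vs)

    us≪vs : us ≪ vs
    us≪vs = All.tabulate λ {a} a∈ → All.tabulate λ {b} b∈ →
      -- Relative order only compares by `_<_`, so `b ≤ a` already yields the pattern and the case
      -- of equality needs no separate treatment.
      ≰⇒> λ b≤a → avoids (subst (_⊒ word p312) (sym eq)
        ( a ∷ 1 ∷ b ∷ [] , ⊆-++⁺ (from∈ a∈) (refl ∷ from∈ b∈) , refl
        , ( mk⇔ (λ a<1 → contradiction (All.lookup us>1 a∈) (<-asym a<1)) (λ { (s≤s ()) })
          ∷ mk⇔ (λ a<b → contradiction b≤a (<⇒≱ a<b)) (λ { (s≤s (s≤s ())) })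
          ∷ [])
        ∷ (mk⇔ (λ _ → s≤s (s≤s z≤n)) (λ _ → All.lookup vs>1 b∈) ∷ [])
        ∷ [] ∷ []))

    length-us-vs : length (us ++ 1 ∷ vs) ≡ suc k + length vs
    length-us-vs = trans (length-++ us) (+-suc k (length vs))

    us≤ : All (_≤ 1 + k) us
    us≤ = All.tabulate λ {a} a∈ → ≮⇒≥ λ k+1<a → <-irrefl refl (≤-trans
      (unique-interval {suc (suc k)} (≤-trans k+1<a (proj₂ (All.lookup (All.++⁻ˡ us all-bounds) a∈))) vs!
         (All.map (≤-<-trans k+1<a) (All.lookup us≪vs a∈))
         (All.map proj₂ (All.tail (All.++⁻ʳ us all-bounds))))
      (≤-reflexive length-us-vs))

    vs> : All (1 + k <_) vs
    vs> = All.tabulate λ {b} b∈ → ≰⇒> λ b≤k+1 → <-irrefl refl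
      (unique-interval {1} {k} (≤-pred (≤-trans (All.lookup vs>1 b∈) b≤k+1)) us! us>1
        (All.map (λ a<vs → ≤-pred (≤-trans (All.lookup a<vs b∈) b≤k+1)) us≪vs))

    left : ∃ λ v → us ≡ List.map suc v × IsPermutation v
    left = shifted-isPermutation 1 us! us>1 us≤

    right : ∃ λ v → vs ≡ List.map (suc k +_) v × IsPermutation v
    right = shifted-isPermutation (suc k) vs! vs>
      (All.map (λ (_ , x≤) → ≤-trans x≤ (≤-reflexive length-us-vs)) (All.tail (All.++⁻ʳ us all-bounds)))

    word-≡ : us ++ 1 ∷ vs ≡
             List.map suc (proj₁ left) ++ 1 ∷ (List.map ((length (proj₁ left) + 1) +_) (proj₁ right) ++ [])
    -- The right part was shifted by `suc k` with `k` the length of `us`, while the inflation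
    -- computes its offset as the size of the left factor plus 1.
    word-≡ = cong₂ (λ u v → u ++ 1 ∷ v) (proj₁ (proj₂ left)) (trans (proj₁ (proj₂ right))
      (trans (cong (λ c → List.map (c +_) (proj₁ right))
               (trans (cong suc (trans (cong length (proj₁ (proj₂ left))) (length-map suc (proj₁ left))))
                      (+-comm 1 (length (proj₁ left)))))
             (sym (++-identityʳ _))))

gluingsAt : ℕ → ℕ → List 𝔖
gluingsAt n k = cartesianProductWith glue (avoiders k) (avoiders (n ∸ k))

gluings : ℕ → List 𝔖
gluings n = concatMap (gluingsAt n) (upTo (suc n))

∈-gluingsAt⁻ : ∀ n k → σ ∈ gluingsAt n k →
             ∃₂ λ σ₁ σ₂ → σ₁ ∈ avoiders k × σ₂ ∈ avoiders (n ∸ k) × σ ≡ glue σ₁ σ₂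
∈-gluingsAt⁻ n k = ∈-cartesianProductWith⁻ glue (avoiders k) (avoiders (n ∸ k))

gluingsAt-unique : ∀ n k → Unique (gluingsAt n k)
gluingsAt-unique n k =
  Unique.cartesianProductWith⁺ glue glue-injective (avoiders-unique k) (avoiders-unique (n ∸ k))

gluings-unique : ∀ n → Unique (gluings n)
gluings-unique n = Unique.concat⁺ {xss = List.map (gluingsAt n) (upTo (suc n))}
  (All.map⁺ {P = Unique} {f = gluingsAt n} (All.tabulate {xs = upTo (suc n)} λ {k} _ → gluingsAt-unique n k))
  (AllPairs.map⁺ {R = Disjoint} {f = gluingsAt n}
    (AllPairs.map (λ {k} {l} → disjoint {k} {l}) (Unique.upTo⁺ (suc n))))
  where
  disjoint : ∀ {k l} → k ≢ l → Disjoint (gluingsAt n k) (gluingsAt n l)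
  disjoint {k} {l} k≢l {σ} (σ∈ , σ∈′) =
    let σ₁ , σ₂ , σ₁∈ , _ , σ≡  = ∈-gluingsAt⁻ {σ} n k σ∈
        τ₁ , τ₂ , τ₁∈ , _ , σ≡′ = ∈-gluingsAt⁻ {σ} n l σ∈′
        σ₁≡τ₁ = proj₁ (glue-injective {σ₁} {σ₂} {τ₁} {τ₂} (trans (sym σ≡) σ≡′))
    in k≢l (trans (sym (proj₁ (∈-avoiders⁻ {σ₁} k σ₁∈)))
         (trans (cong size σ₁≡τ₁) (proj₁ (∈-avoiders⁻ {τ₁} l τ₁∈))))

-- Neither list has repetitions, so having the same members already makes them rearrangements of
-- each other, which is all that a sum depends on.
avoiders-↭-gluings : ∀ n → avoiders (suc n) ↭ gluings n
avoiders-↭-gluings n = ∼bag⇒↭ (unique∧set⇒bag (avoiders-unique (suc n)) (gluings-unique n)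
  (λ {σ} → mk⇔ (to {σ}) (from {σ})))
  where
  to : σ ∈ avoiders (suc n) → σ ∈ gluings n
  to {σ} σ∈ =
    let size-σ , av = ∈-avoiders⁻ {σ} (suc n) σ∈
        σ₁ , σ₂ , σ≡ = unglue σ size-σ av
        av₁ , av₂ = glue-avoids⁻ {σ₁} {σ₂} (subst (_Avoids (p312 ∷ [])) σ≡ av)
        sizes = suc-injective (trans (sym (size-glue σ₁ σ₂)) (trans (cong size (sym σ≡)) size-σ))
        size-σ₂ = trans (sym (m+n∸m≡n (size σ₁) (size σ₂))) (cong (_∸ size σ₁) sizes)
        size-σ₁ = s≤s (≤-trans (m≤m+n (size σ₁) (size σ₂)) (≤-reflexive sizes))
    in subst (_∈ gluings n) (sym σ≡)
         (∈-concatMap⁺ (gluingsAt n) {xs = upTo (suc n)} (lose (∈-upTo⁺ size-σ₁)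
           (∈-cartesianProductWith⁺ glue {xs = avoiders (size σ₁)} {ys = avoiders (n ∸ size σ₁)}
             (∈-avoiders⁺ {σ₁} av₁) (subst (λ m → σ₂ ∈ avoiders m) size-σ₂ (∈-avoiders⁺ {σ₂} av₂)))))
  from : σ ∈ gluings n → σ ∈ avoiders (suc n)
  from {σ} σ∈ =
    let k , k∈ , σ∈′ = find (∈-concatMap⁻ (gluingsAt n) {xs = upTo (suc n)} σ∈)
        σ₁ , σ₂ , σ₁∈ , σ₂∈ , σ≡ = ∈-gluingsAt⁻ {σ} n k σ∈′
        size₁ , av₁ = ∈-avoiders⁻ {σ₁} k σ₁∈
        size₂ , av₂ = ∈-avoiders⁻ {σ₂} (n ∸ k) σ₂∈
        k≤n = ≤-pred (∈-upTo⁻ {n = suc n} k∈)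
    in subst₂ (λ σ m → σ ∈ avoiders m) (sym σ≡)
         (trans (size-glue σ₁ σ₂) (cong suc (trans (cong₂ _+_ size₁ size₂) (m+[n∸m]≡n k≤n))))
         (∈-avoiders⁺ {glue σ₁ σ₂} (glue-avoids⁺ {σ₁} {σ₂} av₁ av₂))

-- Finite sums

∑ : (A → ℕ) → List A → ℕ
∑ f = sum ∘ List.map f

∑-cong : {f g : A → ℕ} → ∀ xs → (∀ {x} → x ∈ xs → f x ≡ g x) → ∑ f xs ≡ ∑ g xs
∑-cong []       f≡g = refl
∑-cong (x ∷ xs) f≡g = cong₂ _+_ (f≡g (here refl)) (∑-cong xs (f≡g ∘ there))

∑-≗ : {f g : A → ℕ} → (∀ x → f x ≡ g x) → ∀ xs → ∑ f xs ≡ ∑ g xs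
∑-≗ f≡g xs = ∑-cong xs (λ {x} _ → f≡g x)

∑-++ : ∀ (f : A → ℕ) xs ys → ∑ f (xs ++ ys) ≡ ∑ f xs + ∑ f ys
∑-++ f xs ys = trans (cong sum (map-++ f xs ys)) (sum-++ (List.map f xs) (List.map f ys))

∑-map : ∀ (f : B → ℕ) (g : A → B) xs → ∑ f (List.map g xs) ≡ ∑ (f ∘ g) xs
∑-map f g xs = cong sum (sym (map-∘ xs))

∑-+ : ∀ (f g : A → ℕ) xs → ∑ (λ x → f x + g x) xs ≡ ∑ f xs + ∑ g xs
∑-+ f g []       = refl
∑-+ f g (x ∷ xs) = trans (cong (f x + g x +_) (∑-+ f g xs)) (interchange (f x) (g x) (∑ f xs) (∑ g xs))

∑-*ˡ : ∀ c (f : A → ℕ) xs → ∑ (λ x → c * f x) xs ≡ c * ∑ f xs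
∑-*ˡ c f []       = sym (*-zeroʳ c)
∑-*ˡ c f (x ∷ xs) = trans (cong (c * f x +_) (∑-*ˡ c f xs)) (sym (*-distribˡ-+ c (f x) (∑ f xs)))

∑-*ʳ : ∀ c (f : A → ℕ) xs → ∑ (λ x → f x * c) xs ≡ ∑ f xs * c
∑-*ʳ c f xs = trans (∑-≗ (λ x → *-comm (f x) c) xs) (trans (∑-*ˡ c f xs) (*-comm c (∑ f xs)))

∑-0 : ∀ (xs : List A) → ∑ (λ _ → 0) xs ≡ 0
∑-0 []       = refl
∑-0 (_ ∷ xs) = ∑-0 xs

∑-swap : ∀ (f : A → B → ℕ) xs ys → ∑ (λ x → ∑ (f x) ys) xs ≡ ∑ (λ y → ∑ (λ x → f x y) xs) ys
∑-swap f []       ys = sym (∑-0 ys)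
∑-swap f (x ∷ xs) ys = trans (cong (∑ (f x) ys +_) (∑-swap f xs ys))
  (sym (∑-+ (f x) (λ y → ∑ (λ x → f x y) xs) ys))

∑-concatMap : ∀ (f : B → ℕ) (g : A → List B) xs → ∑ f (concatMap g xs) ≡ ∑ (λ x → ∑ f (g x)) xs
∑-concatMap f g []       = refl
∑-concatMap f g (x ∷ xs) = trans (∑-++ f (g x) (concatMap g xs)) (cong (∑ f (g x) +_) (∑-concatMap f g xs))

∑-cartesianProductWith : ∀ (h : C → ℕ) (f : A → B → C) xs ys →
  ∑ h (cartesianProductWith f xs ys) ≡ ∑ (λ x → ∑ (λ y → h (f x y)) ys) xs
∑-cartesianProductWith h f []       ys = refl
∑-cartesianProductWith h f (x ∷ xs) ys = trans (∑-++ h (List.map (f x) ys) _)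
  (cong₂ _+_ (∑-map h (f x) ys) (∑-cartesianProductWith h f xs ys))

∑-↭ : ∀ (f : A → ℕ) {xs ys} → xs ↭ ys → ∑ f xs ≡ ∑ f ys
∑-↭ f xs↭ys = sum-↭ (↭-map⁺ f xs↭ys)

∑-≥ : ∀ (f : A → ℕ) {x} xs → x ∈ xs → f x ≤ ∑ f xs
∑-≥ f (x ∷ xs) (here refl) = m≤m+n (f x) (∑ f xs)
∑-≥ f (x ∷ xs) (there x∈)  = ≤-trans (∑-≥ f xs x∈) (m≤n+m (∑ f xs) (f x))

∑-upTo-suc : ∀ (f : ℕ → ℕ) n → ∑ f (upTo (suc n)) ≡ f 0 + ∑ (f ∘ suc) (upTo n)
∑-upTo-suc f n = cong (f 0 +_) (trans (cong (∑ f) (sym (map-upTo suc n))) (∑-map f suc (upTo n)))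

∑-upTo-∷ʳ : ∀ (f : ℕ → ℕ) n → ∑ f (upTo (suc n)) ≡ ∑ f (upTo n) + f n
∑-upTo-∷ʳ f n = trans (cong (∑ f) (sym (upTo-∷ʳ n)))
  (trans (∑-++ f (upTo n) [ n ]) (cong (∑ f (upTo n) +_) (+-identityʳ (f n))))

-- Expands an arbitrary test function in the coefficients of monomials, the only data that Wilf
-- equivalence supplies.
∑-monomial : ∀ (g : ℕ → ℕ) {x} M → x < M → ∑ (λ j → g j * (q^ x) j) (upTo M) ≡ g x
∑-monomial g {zero}  (suc M) _         = begin
  ∑ (λ j → g j * (q^ 0) j) (upTo (suc M))     ≡⟨ ∑-upTo-suc (λ j → g j * (q^ 0) j) M ⟩
  g 0 * 1 + ∑ (λ j → g (suc j) * 0) (upTo M)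
    ≡⟨ cong₂ _+_ (*-identityʳ (g 0)) (trans (∑-*ʳ 0 (g ∘ suc) (upTo M)) (*-zeroʳ (∑ (g ∘ suc) (upTo M)))) ⟩
  g 0 + 0                                     ≡⟨ +-identityʳ (g 0) ⟩
  g 0                                         ∎
  where open ≡-Reasoning
∑-monomial g {suc x} (suc M) (s≤s x<M) =
  trans (∑-upTo-suc (λ j → g j * (q^ suc x) j) M) (cong₂ _+_ (*-zeroʳ (g 0)) (∑-monomial (g ∘ suc) M x<M))

-- Indicators

χ : Dec A → ℕ
χ A? = if does A? then 1 else 0

χ-yes : (A? : Dec A) → A → χ A? ≡ 1
χ-yes (yes _) _ = refl
χ-yes (no ¬a) a = contradiction a ¬a

χ-no : (A? : Dec A) → ¬ A → χ A? ≡ 0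
χ-no (yes a) ¬a = contradiction a ¬a
χ-no (no _)  _  = refl

χ-⇔ : (A? : Dec A) (B? : Dec B) → A ⇔ B → χ A? ≡ χ B?
χ-⇔ (yes a) B? e = sym (χ-yes B? (Equivalence.to e a))
χ-⇔ (no ¬a) B? e = sym (χ-no B? (¬a ∘ Equivalence.from e))

-- Inclusion–exclusion for a union of products of a decreasing and an increasing chain,
-- with the subtracted terms moved to the other side.
module _ {P Q : ℕ → Set} (P? : Decidable P) (Q? : Decidable Q)
         (P-step : ∀ j → P (suc j) → P j) (Q-step : ∀ j → Q j → Q (suc j)) where

  someBelow? : ∀ r → Dec (∃ λ j → j < r × P j × Q j)
  someBelow? = anyUpTo? (λ j → P? j ×-dec Q? j)

  P-antitone : ∀ {i j} → i ≤ j → P j → P i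
  P-antitone {i} {zero}  z≤n p = p
  P-antitone {i} {suc j} i≤j p with i ≟ suc j
  ... | yes refl = p
  ... | no i≢    = P-antitone (≤-pred (≤∧≢⇒< i≤j i≢)) (P-step j p)

  Q-monotone : ∀ {i j} → i ≤ j → Q i → Q j
  Q-monotone {i} {zero}  z≤n q = q
  Q-monotone {i} {suc j} i≤j q with i ≟ suc j
  ... | yes refl = q
  ... | no i≢    = Q-step j (Q-monotone (≤-pred (≤∧≢⇒< i≤j i≢)) q)

  -- Once the last `P` holds, the union collapses: every earlier `Q` implies `Q r`, and `r` itself
  -- is a witness.
  someBelow-suc : ∀ r → P r → (∃ λ j → j < suc r × P j × Q j) ⇔ Q r
  someBelow-suc r p = mk⇔
    (λ (j , j< , _ , q) → Q-monotone (≤-pred j<) q)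
    (λ q → r , ≤-refl , p , q)

  -- The new event meets the old union exactly in `P (suc r)` and `Q r`. If `P (suc r)` holds then
  -- so does `P r`, and the two unions collapse to `Q (suc r)` and `Q r`; otherwise nothing is
  -- added.
  χ-step : ∀ r (p? : Dec (P (suc r))) →
           χ (someBelow? (suc (suc r))) + χ p? * χ (Q? r) ≡ χ (someBelow? (suc r)) + χ p? * χ (Q? (suc r))
  χ-step r (yes p) = begin
    χ (someBelow? (suc (suc r))) + (χ (Q? r) + 0)
      ≡⟨ cong₂ _+_ (χ-⇔ (someBelow? (suc (suc r))) (Q? (suc r)) (someBelow-suc (suc r) p)) (+-identityʳ _) ⟩
    χ (Q? (suc r)) + χ (Q? r)
      ≡⟨ +-comm (χ (Q? (suc r))) (χ (Q? r)) ⟩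
    χ (Q? r) + χ (Q? (suc r))
      ≡⟨ cong₂ _+_ (χ-⇔ (someBelow? (suc r)) (Q? r) (someBelow-suc r (P-step r p))) (+-identityʳ _) ⟨
    χ (someBelow? (suc r)) + (χ (Q? (suc r)) + 0) ∎
    where open ≡-Reasoning
  χ-step r (no ¬p) = cong (_+ 0) (χ-⇔ (someBelow? (suc (suc r))) (someBelow? (suc r)) (mk⇔
    (λ (j , j< , p , q) → j , ≤∧≢⇒< (≤-pred j<) (λ { refl → ¬p p }) , p , q)
    (λ (j , j< , pq) → j , m≤n⇒m≤1+n j< , pq)))

  χ-someBelow-zero : (p? : Dec (P 0)) → χ (someBelow? 1) ≡ χ p? * χ (Q? 0)
  χ-someBelow-zero (yes p) = trans (χ-⇔ (someBelow? 1) (Q? 0) (someBelow-suc 0 p)) (sym (+-identityʳ _))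
  χ-someBelow-zero (no ¬p) = χ-no (someBelow? 1) λ { (zero , _ , p , _) → ¬p p ; (suc _ , s≤s () , _) }

  χ-someBelow : ∀ r → χ (someBelow? (suc r)) + ∑ (λ j → χ (P? (suc j)) * χ (Q? j)) (upTo r) ≡
                      ∑ (λ j → χ (P? j) * χ (Q? j)) (upTo (suc r))
  χ-someBelow zero    = cong (_+ 0) (χ-someBelow-zero (P? 0))
  χ-someBelow (suc r) = begin
    E₂ + ∑ f (upTo (suc r))                                  ≡⟨ cong (E₂ +_) (∑-upTo-∷ʳ f r) ⟩
    E₂ + (∑ f (upTo r) + f r)                                ≡⟨ x+[y+z]≡[x+z]+y E₂ (∑ f (upTo r)) (f r) ⟩
    (E₂ + f r) + ∑ f (upTo r)                                ≡⟨ cong (_+ ∑ f (upTo r)) (χ-step r (P? (suc r))) ⟩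
    (E₁ + g (suc r)) + ∑ f (upTo r)                          ≡⟨ x+[y+z]≡[x+z]+y E₁ (∑ f (upTo r)) (g (suc r)) ⟨
    E₁ + (∑ f (upTo r) + g (suc r))                          ≡⟨ +-assoc E₁ (∑ f (upTo r)) (g (suc r)) ⟨
    (E₁ + ∑ f (upTo r)) + g (suc r)                          ≡⟨ cong (_+ g (suc r)) (χ-someBelow r) ⟩
    ∑ g (upTo (suc r)) + g (suc r)                           ≡⟨ ∑-upTo-∷ʳ g (suc r) ⟨
    ∑ g (upTo (suc (suc r)))                                 ∎
    where
    open ≡-Reasoning
    E₁ = χ (someBelow? (suc r))
    E₂ = χ (someBelow? (suc (suc r)))
    f g : ℕ → ℕ
    f j = χ (P? (suc j)) * χ (Q? j)
    g j = χ (P? j) * χ (Q? j)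
    x+[y+z]≡[x+z]+y : ∀ x y z → x + (y + z) ≡ (x + z) + y
    x+[y+z]≡[x+z]+y x y z = trans (cong (x +_) (+-comm y z)) (sym (+-assoc x z y))

-- Equidistribution

module _ {X : Set} (st : X → ℕ) where

  -- The weights a and a′ give st the same distribution on xs.
  Equidistributed : List X → (a a′ : X → ℕ) → Set
  Equidistributed xs a a′ = ∀ (g : ℕ → ℕ) → ∑ (λ x → a x * g (st x)) xs ≡ ∑ (λ x → a′ x * g (st x)) xs

  equidistributed-monomials : ∀ xs a a′ →
    (∀ j → ∑ (λ x → a x * (q^ st x) j) xs ≡ ∑ (λ x → a′ x * (q^ st x) j) xs) → Equidistributed xs a a′
  equidistributed-monomials xs a a′ same g = trans (expand a)
    (trans (∑-≗ (λ j → cong (g j *_) (same j)) (upTo M)) (sym (expand a′)))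
    where
    open ≡-Reasoning
    -- The sum of all values of `st` bounds each of them, and `suc` makes the bound strict, as
    -- `∑-monomial` requires.
    M = suc (∑ st xs)
    expand : ∀ a → ∑ (λ x → a x * g (st x)) xs ≡ ∑ (λ j → g j * ∑ (λ x → a x * (q^ st x) j) xs) (upTo M)
    expand a = begin
      ∑ (λ x → a x * g (st x)) xs
        ≡⟨ ∑-cong xs (λ {x} x∈ → cong (a x *_) (sym (∑-monomial g M (s≤s (∑-≥ st xs x∈))))) ⟩
      ∑ (λ x → a x * ∑ (λ j → g j * (q^ st x) j) (upTo M)) xs
        ≡⟨ ∑-≗ (λ x → trans (sym (∑-*ˡ (a x) _ (upTo M)))
                          (∑-≗ (λ j → x∙yz≈y∙xz (a x) (g j) _) (upTo M))) xs ⟩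
      ∑ (λ x → ∑ (λ j → g j * (a x * (q^ st x) j)) (upTo M)) xs
        ≡⟨ ∑-swap _ xs (upTo M) ⟩
      ∑ (λ j → ∑ (λ x → g j * (a x * (q^ st x) j)) xs) (upTo M)
        ≡⟨ ∑-≗ (λ j → ∑-*ˡ (g j) (λ x → a x * (q^ st x) j) xs) (upTo M) ⟩
      ∑ (λ j → g j * ∑ (λ x → a x * (q^ st x) j) xs) (upTo M) ∎

  equidistributed-≗ : ∀ {a b a′ b′} xs → (∀ x → a x ≡ b x) → (∀ x → a′ x ≡ b′ x) →
                      Equidistributed xs b b′ → Equidistributed xs a a′
  equidistributed-≗ xs a≡b a′≡b′ e g = trans (∑-≗ (λ x → cong (λ c → c * g (st x)) (a≡b x)) xs)
    (trans (e g) (∑-≗ (λ x → cong (λ c → c * g (st x)) (sym (a′≡b′ x))) xs))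

  module _ (xs ys : List X) (h : ℕ → ℕ → ℕ) where

    pairSum : (X → X → ℕ) → ℕ
    pairSum c = ∑ (λ x → ∑ (λ y → c x y * h (st x) (st y)) ys) xs

    -- The factors are exchanged one at a time. For fixed `x`, the kernel is a test function of
    -- `st y`; after that exchange the inner sum depends on `x` only through `st x` and serves as a
    -- test function for the other factor.
    pairSum-product : ∀ a a′ b b′ → Equidistributed xs a a′ → Equidistributed ys b b′ →
                      pairSum (λ x y → a x * b y) ≡ pairSum (λ x y → a′ x * b′ y)
    pairSum-product a a′ b b′ ea eb = trans (factor a b)
      (trans (∑-≗ (λ x → cong (a x *_) (eb (h (st x)))) xs)
        (trans (ea (λ i → ∑ (λ y → b′ y * h i (st y)) ys)) (sym (factor a′ b′))))
      where
      factor : ∀ a b → pairSum (λ x y → a x * b y) ≡ ∑ (λ x → a x * ∑ (λ y → b y * h (st x) (st y)) ys) xs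
      factor a b = ∑-≗ (λ x → trans (∑-≗ (λ y → *-assoc (a x) (b y) _) ys) (∑-*ˡ (a x) _ ys)) xs

    pairSum-+ : ∀ c d → pairSum (λ x y → c x y + d x y) ≡ pairSum c + pairSum d
    pairSum-+ c d = trans
      (∑-≗ (λ x → trans (∑-≗ (λ y → *-distribʳ-+ (h (st x) (st y)) (c x y) (d x y)) ys) (∑-+ _ _ ys)) xs)
      (∑-+ _ _ xs)

    pairSum-∑ : ∀ (c : ℕ → X → X → ℕ) js → pairSum (λ x y → ∑ (λ j → c j x y) js) ≡ ∑ (λ j → pairSum (c j)) js
    pairSum-∑ c js = trans
      (∑-≗ (λ x → trans (∑-≗ (λ y → sym (∑-*ʳ (h (st x) (st y)) (λ j → c j x y) js)) ys)
                        (∑-swap (λ y j → c j x y * h (st x) (st y)) ys js)) xs)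
      (∑-swap (λ x j → ∑ (λ y → c j x y * h (st x) (st y)) ys) xs js)

    pairSum-≗ : ∀ {c d} → (∀ x y → c x y ≡ d x y) → pairSum c ≡ pairSum d
    pairSum-≗ c≡d = ∑-≗ (λ x → ∑-≗ (λ y → cong (λ k → k * h (st x) (st y)) (c≡d x y)) ys) xs

    -- Here `c` and `c′` stand for the indicators of the two unions. Their correction terms agree by
    -- `pairSum-product` and are cancelled, so no subtraction of natural numbers occurs.
    pairSum-telescope : ∀ r {c c′ : X → X → ℕ} {a a′ b b′ : ℕ → X → ℕ} →
      (∀ x y → c x y + ∑ (λ j → a (suc j) x * b j y) (upTo r) ≡ ∑ (λ j → a j x * b j y) (upTo (suc r))) →
      (∀ x y → c′ x y + ∑ (λ j → a′ (suc j) x * b′ j y) (upTo r) ≡ ∑ (λ j → a′ j x * b′ j y) (upTo (suc r))) →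
      (∀ j → Equidistributed xs (a j) (a′ j)) → (∀ j → Equidistributed ys (b j) (b′ j)) →
      pairSum c ≡ pairSum c′
    pairSum-telescope r {c} {c′} {a} {a′} {b} {b′} eq eq′ ea eb =
      +-cancelʳ-≡ (S a b) (pairSum c) (pairSum c′) (begin
      pairSum c + S a b                                                    ≡⟨ total-sum c a b eq ⟩
      ∑ (λ j → pairSum (λ x y → a j x * b j y)) (upTo (suc r))
        ≡⟨ ∑-≗ (λ j → pairSum-product (a j) (a′ j) (b j) (b′ j) (ea j) (eb j)) (upTo (suc r)) ⟩
      ∑ (λ j → pairSum (λ x y → a′ j x * b′ j y)) (upTo (suc r))           ≡⟨ total-sum c′ a′ b′ eq′ ⟨
      pairSum c′ + S a′ b′
        ≡⟨ cong (pairSum c′ +_) (∑-≗ (λ j →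
             pairSum-product (a (suc j)) (a′ (suc j)) (b j) (b′ j) (ea (suc j)) (eb j)) (upTo r)) ⟨
      pairSum c′ + S a b                                                   ∎)
      where
      open ≡-Reasoning
      S : (a b : ℕ → X → ℕ) → ℕ
      S a b = ∑ (λ j → pairSum (λ x y → a (suc j) x * b j y)) (upTo r)
      total-sum : ∀ (c : X → X → ℕ) (a b : ℕ → X → ℕ) →
        (∀ x y → c x y + ∑ (λ j → a (suc j) x * b j y) (upTo r) ≡ ∑ (λ j → a j x * b j y) (upTo (suc r))) →
        pairSum c + S a b ≡ ∑ (λ j → pairSum (λ x y → a j x * b j y)) (upTo (suc r))
      total-sum c a b eq = begin
        pairSum c + S a b
          ≡⟨ cong (pairSum c +_) (pairSum-∑ (λ j x y → a (suc j) x * b j y) (upTo r)) ⟨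
        pairSum c + pairSum (λ x y → ∑ (λ j → a (suc j) x * b j y) (upTo r))
          ≡⟨ pairSum-+ c _ ⟨
        pairSum (λ x y → c x y + ∑ (λ j → a (suc j) x * b j y) (upTo r))
          ≡⟨ pairSum-≗ eq ⟩
        pairSum (λ x y → ∑ (λ j → a j x * b j y) (upTo (suc r)))
          ≡⟨ pairSum-∑ (λ j x y → a j x * b j y) (upTo (suc r)) ⟩
        ∑ (λ j → pairSum (λ x y → a j x * b j y)) (upTo (suc r)) ∎

-- Containment of sums of starred patterns

Pointwise-take : {R : A → B → Set} → ∀ j {xs ys} → Pointwise R xs ys → Pointwise R (take j xs) (take j ys)
Pointwise-take zero    _        = []
Pointwise-take (suc j) []       = []
Pointwise-take (suc j) (r ∷ rs) = r ∷ Pointwise-take j rs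

Pointwise-drop : {R : A → B → Set} → ∀ j {xs ys} → Pointwise R xs ys → Pointwise R (drop j xs) (drop j ys)
Pointwise-drop zero    rs       = rs
Pointwise-drop (suc j) []       = []
Pointwise-drop (suc j) (r ∷ rs) = Pointwise-drop j rs

containsStars : List 𝔖 → 𝔖 → ℕ
containsStars πs σ = χ (word σ ⊒? stars πs)

starContainsStars : List 𝔖 → 𝔖 → ℕ
starContainsStars πs σ = χ (word (σ *) ⊒? stars πs)

containsStars-glue : ∀ πs σ₁ σ₂ →
  containsStars πs (glue σ₁ σ₂) +
    ∑ (λ j → starContainsStars (take (suc j) πs) σ₁ * containsStars (drop j πs) σ₂) (upTo (length πs)) ≡
  ∑ (λ j → starContainsStars (take j πs) σ₁ * containsStars (drop j πs) σ₂) (upTo (suc (length πs)))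
containsStars-glue πs σ₁ σ₂ = trans
  (cong (_+ ∑ (λ j → χ (P? (suc j)) * χ (Q? j)) (upTo (length πs)))
    (χ-⇔ (word (glue σ₁ σ₂) ⊒? stars πs) (someBelow? P? Q? P-step Q-step (suc (length πs))) e))
  (χ-someBelow P? Q? P-step Q-step (length πs))
  where
  P? = λ j → word (σ₁ *) ⊒? stars (take j πs)
  Q? = λ j → word σ₂ ⊒? stars (drop j πs)
  P-step = ⊒-stars-take (word (σ₁ *)) πs
  Q-step = ⊒-stars-drop (word σ₂) πs
  open Equivalence (glue-⊒ σ₁ σ₂ πs)
  e = mk⇔ (λ h → case to h of λ (j , j≤ , pq) → j , s≤s j≤ , pq)
          (λ (j , j< , pq) → from (j , ≤-pred j< , pq))

containsStars-empty : ∀ σ π πs → size σ ≡ 0 → containsStars (π ∷ πs) σ ≡ 0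
containsStars-empty σ π πs size≡0 = χ-no (word σ ⊒? stars (π ∷ πs)) λ h →
  let u , s , e = ⊒⁻ h
      p , x , eq , _ = last-stars 0 π πs
  in 1+n≰n (≤-trans (m≤n+m 1 (length p))
       (≤-trans (≤-reflexive (sym (length-++ p)))
         (≤-trans (≤-reflexive (trans (cong length (sym eq)) (sym (≈-length e))))
           (≤-trans (length-mono-≤ s) (≤-reflexive size≡0)))))

-- From avoidance to containment and back

avoidanceSum : (𝔖 → ℕ) → 𝔖 → List 𝔖 → ℕ[q]
avoidanceSum st π σs =
  foldr _+ₚ_ 0ₚ (List.map (λ σ → q^ (st σ)) (filter (_avoids? (p312 ∷ π ∷ [])) σs))

-- Stated for any list in place of `permutations n` so that induction on the list applies, and
-- additively because coefficients lie in ℕ.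
avoidanceSum-complement : ∀ st π j σs →
  avoidanceSum st π σs j +
    ∑ (λ σ → χ (σ contains? π) * (q^ st σ) j) (filter (_avoids? (p312 ∷ [])) σs) ≡
  ∑ (λ σ → (q^ st σ) j) (filter (_avoids? (p312 ∷ [])) σs)
avoidanceSum-complement st π j [] = refl
avoidanceSum-complement st π j (σ ∷ σs) = cases (σ contains? p312) (σ contains? π)
  where
  open ≡-Reasoning
  coefficient = λ (σs : List 𝔖) → foldr _+ₚ_ 0ₚ (List.map (λ σ → q^ (st σ)) σs) j
  weight = λ σ → χ (σ contains? π) * (q^ st σ) j
  monomial = λ σ → (q^ st σ) j
  one? = _avoids? (p312 ∷ [])
  both? = _avoids? (p312 ∷ π ∷ [])
  goal : List 𝔖 → List 𝔖 → Set
  goal σs τs = coefficient σs + ∑ weight τs ≡ ∑ monomial τs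
  ih : goal (filter both? σs) (filter one? σs)
  ih = avoidanceSum-complement st π j σs
  cases : Dec (σ Contains p312) → Dec (σ Contains π) → goal (filter both? (σ ∷ σs)) (filter one? (σ ∷ σs))
  cases (yes h) _ = subst₂ goal
    (sym (filter-reject both? λ { (¬h ∷ _) → ¬h h })) (sym (filter-reject one? λ { (¬h ∷ _) → ¬h h })) ih
  cases (no ¬h) (yes k) = subst₂ goal
    (sym (filter-reject both? λ { (_ ∷ ¬k ∷ []) → ¬k k })) (sym (filter-accept one? (¬h ∷ [])))
    (begin
      T + (weight σ + S)      ≡⟨ cong (λ w → T + (w * monomial σ + S)) (χ-yes (σ contains? π) k) ⟩
      T + (monomial σ + 0 + S) ≡⟨ cong (λ m → T + (m + S)) (+-identityʳ (monomial σ)) ⟩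
      T + (monomial σ + S)    ≡⟨ +-assoc T (monomial σ) S ⟨
      T + monomial σ + S      ≡⟨ cong (_+ S) (+-comm T (monomial σ)) ⟩
      monomial σ + T + S      ≡⟨ +-assoc (monomial σ) T S ⟩
      monomial σ + (T + S)    ≡⟨ cong (monomial σ +_) ih ⟩
      monomial σ + ∑ monomial (filter one? σs) ∎)
    where
    T = coefficient (filter both? σs)
    S = ∑ weight (filter one? σs)
  cases (no ¬h) (no ¬k) = subst₂ goal
    (sym (filter-accept both? (¬h ∷ ¬k ∷ []))) (sym (filter-accept one? (¬h ∷ [])))
    (begin
      monomial σ + T + (weight σ + S)
        ≡⟨ cong (λ w → monomial σ + T + (w * monomial σ + S)) (χ-no (σ contains? π) ¬k) ⟩
      monomial σ + T + S              ≡⟨ +-assoc (monomial σ) T S ⟩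
      monomial σ + (T + S)            ≡⟨ cong (monomial σ +_) ih ⟩
      monomial σ + ∑ monomial (filter one? σs) ∎)
    where
    T = coefficient (filter both? σs)
    S = ∑ weight (filter one? σs)

F-complement : ∀ st n π j →
  F st n (p312 ∷ π ∷ []) j + ∑ (λ σ → χ (σ contains? π) * (q^ st σ) j) (avoiders n) ≡
  ∑ (λ σ → (q^ st σ) j) (avoiders n)
F-complement st n π j = avoidanceSum-complement st π j (permutations n)

-- The form of Wilf equivalence that the induction handles: complementary events, all test
-- functions.
EquiContained : (𝔖 → ℕ) → 𝔖 → 𝔖 → Set
EquiContained st π π′ = ∀ n →
  Equidistributed st (avoiders n) (λ σ → χ (σ contains? π)) (λ σ → χ (σ contains? π′))

wilfEquivalent⇒equiContained : ∀ st π π′ →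
  WilfEquivalent st (p312 ∷ π ∷ []) (p312 ∷ π′ ∷ []) → EquiContained st π π′
wilfEquivalent⇒equiContained st π π′ wilf n =
  equidistributed-monomials st (avoiders n)
    (λ σ → χ (σ contains? π)) (λ σ → χ (σ contains? π′)) λ j →
  +-cancelˡ-≡ (F st n (p312 ∷ π ∷ []) j) _ _
    (trans (F-complement st n π j)
      (trans (sym (F-complement st n π′ j))
        (cong (_+ ∑ (λ σ → χ (σ contains? π′) * (q^ st σ) j) (avoiders n)) (sym (wilf n j)))))

equiContained⇒wilfEquivalent : ∀ st π π′ →
  EquiContained st π π′ → WilfEquivalent st (p312 ∷ π ∷ []) (p312 ∷ π′ ∷ [])
equiContained⇒wilfEquivalent st π π′ equi n j =
  +-cancelʳ-≡ (∑ (λ σ → χ (σ contains? π) * (q^ st σ) j) (avoiders n)) _ _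
    (trans (F-complement st n π j)
      (trans (sym (F-complement st n π′ j))
        -- This test function extracts the coefficient with exponent `j`.
        (cong (F st n (p312 ∷ π′ ∷ []) j +_) (sym (equi n (λ x → (q^ x) j))))))

-- Induction on the size of the permutations

module _
  (st : 𝔖 → ℕ) (f : ℕ → ℕ → ℕ)
  (st-glue : ∀ n k → k ≤ n → ∀ σ₁ σ₂ →
    size σ₁ ≡ k → σ₁ Avoids (p312 ∷ []) →
    size σ₂ ≡ n ∸ k → σ₂ Avoids (p312 ∷ []) →
    st (inflate p213 (σ₁ ∷ p1 ∷ σ₂ ∷ [])) ≡ f k (n ∸ k) + st σ₁ + st σ₂) where

  Equi : ℕ → List 𝔖 → List 𝔖 → Set
  Equi n πs π′s = Equidistributed st (avoiders n) (containsStars πs) (containsStars π′s)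

  -- A single summand is where the hypothesis on an individual pair of patterns enters. With more
  -- summands the star on the host has no effect, and the equidistribution for the same sum is
  -- passed through.
  starContainsStars-equi : ∀ n {πs π′s} → Pointwise (EquiContained st) πs π′s → Equi n πs π′s →
    Equidistributed st (avoiders n) (starContainsStars πs) (starContainsStars π′s)
  starContainsStars-equi n [] _ g = refl
  starContainsStars-equi n {π ∷ []} {π′ ∷ []} (e ∷ []) _ =
    equidistributed-≗ st (avoiders n) (λ σ → singleton σ π) (λ σ → singleton σ π′) (e n)
    where
    singleton : ∀ σ π → starContainsStars (π ∷ []) σ ≡ χ (σ contains? π)
    singleton σ π = χ-⇔ (word (σ *) ⊒? stars (π ∷ [])) (σ contains? π) (⊒-stars-singleton σ π)
  starContainsStars-equi n {π ∷ ρ ∷ πs} {π′ ∷ ρ′ ∷ π′s} (_ ∷ _ ∷ _) =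
    equidistributed-≗ st (avoiders n) (λ σ → several σ π ρ πs) (λ σ → several σ π′ ρ′ π′s)
    where
    several : ∀ σ π ρ πs → starContainsStars (π ∷ ρ ∷ πs) σ ≡ containsStars (π ∷ ρ ∷ πs) σ
    several σ π ρ πs = χ-⇔
      (word (σ *) ⊒? stars (π ∷ ρ ∷ πs)) (word σ ⊒? stars (π ∷ ρ ∷ πs)) (⊒-stars-∷∷ σ π ρ πs)

  -- A recurrence over the position `k + 1` of the letter 1. For fixed `k` the hypothesis on `st`
  -- makes the test function depend on the two factors through their statistics alone, as `pairSum`
  -- demands.
  sum-avoiders-suc : ∀ n (a : 𝔖 → ℕ) (g : ℕ → ℕ) →
    ∑ (λ σ → a σ * g (st σ)) (avoiders (suc n)) ≡
    ∑ (λ k → pairSum st (avoiders k) (avoiders (n ∸ k)) (λ x y → g (f k (n ∸ k) + x + y))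
               (λ σ₁ σ₂ → a (glue σ₁ σ₂))) (upTo (suc n))
  sum-avoiders-suc n a g = begin
    ∑ h (avoiders (suc n))
      ≡⟨ ∑-↭ h (avoiders-↭-gluings n) ⟩
    ∑ h (gluings n)
      ≡⟨ ∑-concatMap h (gluingsAt n) (upTo (suc n)) ⟩
    ∑ (λ k → ∑ h (gluingsAt n k)) (upTo (suc n))
      ≡⟨ ∑-cong (upTo (suc n)) (λ {k} k∈ → trans
           (∑-cartesianProductWith h glue (avoiders k) (avoiders (n ∸ k)))
           (∑-cong (avoiders k) λ {σ₁} σ₁∈ → ∑-cong (avoiders (n ∸ k)) λ {σ₂} σ₂∈ →
             cong (λ s → a (glue σ₁ σ₂) * g s)
               (st-glue′ k (≤-pred (∈-upTo⁻ {n = suc n} k∈)) σ₁ σ₂ σ₁∈ σ₂∈))) ⟩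
    _ ∎
    where
    open ≡-Reasoning
    h : 𝔖 → ℕ
    h σ = a σ * g (st σ)
    st-glue′ : ∀ k → k ≤ n → ∀ σ₁ σ₂ → σ₁ ∈ avoiders k → σ₂ ∈ avoiders (n ∸ k) →
               st (glue σ₁ σ₂) ≡ f k (n ∸ k) + st σ₁ + st σ₂
    st-glue′ k k≤n σ₁ σ₂ σ₁∈ σ₂∈ =
      let size₁ , av₁ = ∈-avoiders⁻ {σ₁} k σ₁∈
          size₂ , av₂ = ∈-avoiders⁻ {σ₂} (n ∸ k) σ₂∈
      in st-glue n k k≤n σ₁ σ₂ size₁ av₁ size₂ av₂

  containsStars-equi : ∀ n {πs π′s} → Pointwise (EquiContained st) πs π′s → Equi n πs π′s
  containsStars-equi = <-rec (λ n → ∀ {πs π′s} → Pointwise (EquiContained st) πs π′s → Equi n πs π′s) step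
    where
    step : ∀ n → (∀ {m} → m < n → ∀ {πs π′s} → Pointwise (EquiContained st) πs π′s → Equi m πs π′s) →
           ∀ {πs π′s} → Pointwise (EquiContained st) πs π′s → Equi n πs π′s
    step n       ih []       g = refl
    step zero    ih {π ∷ πs} {π′ ∷ π′s} (_ ∷ _) g = ∑-cong (avoiders 0) λ {σ} σ∈ →
      let size≡0 = proj₁ (∈-avoiders⁻ {σ} 0 σ∈) in
      cong (λ c → c * g (st σ))
        (trans (containsStars-empty σ π πs size≡0) (sym (containsStars-empty σ π′ π′s size≡0)))
    step (suc n) ih {πs} {π′s} es@(_ ∷ _) g = begin
      ∑ (λ σ → containsStars πs σ * g (st σ)) (avoiders (suc n))
        ≡⟨ sum-avoiders-suc n (containsStars πs) g ⟩
      ∑ (λ k → split k πs) (upTo (suc n))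
        ≡⟨ ∑-cong (upTo (suc n)) (λ {k} k∈ → split-equi k (∈-upTo⁻ {n = suc n} k∈)) ⟩
      ∑ (λ k → split k π′s) (upTo (suc n))
        ≡⟨ sum-avoiders-suc n (containsStars π′s) g ⟨
      ∑ (λ σ → containsStars π′s σ * g (st σ)) (avoiders (suc n)) ∎
      where
      open ≡-Reasoning
      split : ℕ → List 𝔖 → ℕ
      split k πs = pairSum st (avoiders k) (avoiders (n ∸ k)) (λ x y → g (f k (n ∸ k) + x + y))
                     (λ σ₁ σ₂ → containsStars πs (glue σ₁ σ₂))
      split-equi : ∀ k → k < suc n → split k πs ≡ split k π′s
      split-equi k k<suc-n = pairSum-telescope st (avoiders k) (avoiders (n ∸ k))
        (λ x y → g (f k (n ∸ k) + x + y)) (length πs)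
        {c = λ σ₁ σ₂ → containsStars πs (glue σ₁ σ₂)} {c′ = λ σ₁ σ₂ → containsStars π′s (glue σ₁ σ₂)}
        {a = λ j → starContainsStars (take j πs)} {a′ = λ j → starContainsStars (take j π′s)}
        {b = λ j → containsStars (drop j πs)} {b′ = λ j → containsStars (drop j π′s)}
        (containsStars-glue πs)
        -- Both telescoping identities must run over the same range of cuts, so the primed one is
        -- transported along the equality of lengths.
        (subst (λ r → ∀ σ₁ σ₂ → containsStars π′s (glue σ₁ σ₂) +
             ∑ (λ j → starContainsStars (take (suc j) π′s) σ₁ * containsStars (drop j π′s) σ₂) (upTo r) ≡
             ∑ (λ j → starContainsStars (take j π′s) σ₁ * containsStars (drop j π′s) σ₂) (upTo (suc r)))
           (sym (Pointwise.Pointwise-length es)) (containsStars-glue π′s))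
        -- The host shrinks even when the pattern does not: at the extreme cuts the whole sum goes
        -- to one factor, whose size is still at most `n`.
        (λ j → starContainsStars-equi k (Pointwise-take j es) (ih k<suc-n (Pointwise-take j es)))
        (λ j → ih (s≤s (m∸n≤m n k)) (Pointwise-drop j es))

Pointwise-toList : {R : A → A → Set} → ∀ {n} (xs ys : Vec A n) → (∀ i → R (lookup xs i) (lookup ys i)) →
                   Pointwise R (toList xs) (toList ys)
Pointwise-toList []       []       rs = []
Pointwise-toList (_ ∷ xs) (_ ∷ ys) rs = rs zero ∷ Pointwise-toList xs ys (rs ∘ suc)

corollary2p6 : (st : 𝔖 → ℕ) (f : ℕ → ℕ → ℕ) →
    (∀ n k → k ≤ n → ∀ σ₁ σ₂ →
    size σ₁ ≡ k → σ₁ Avoids (p312 ∷ []) →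
    size σ₂ ≡ n ∸ k → σ₂ Avoids (p312 ∷ []) →
    st (inflate p213 (σ₁ ∷ p1 ∷ σ₂ ∷ [])) ≡ f k (n ∸ k) + st σ₁ + st σ₂) →
    (r : ℕ) (π π′ : Vec 𝔖 r) →
    (∀ (i : Fin r) →
    WilfEquivalent st (p312 ∷ lookup π i ∷ []) (p312 ∷ lookup π′ i ∷ [])) →
    WilfEquivalent st (p312 ∷ ι[ map _* π ] ∷ []) (p312 ∷ ι[ map _* π′ ] ∷ [])
corollary2p6 st f st-glue r π π′ wilf = equiContained⇒wilfEquivalent st _ _ λ n →
  equidistributed-≗ st (avoiders n) (contains-ι π) (contains-ι π′)
    (containsStars-equi st f st-glue n
      (Pointwise-toList π π′ λ i → wilfEquivalent⇒equiContained st _ _ (wilf i)))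
  where
  contains-ι : ∀ (π : Vec 𝔖 r) σ → χ (σ contains? ι[ map _* π ]) ≡ containsStars (toList π) σ
  contains-ι π σ = cong (λ p → χ (word σ ⊒? p)) (word-ι-* π)
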